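{- Suppose $f:2^\Omega\to\mathbb{R}_+$ is monotone and submodular. Then for any finite $O\subset\Omega$ and any $A\in\mathbb{R}_+^\Omega$, $$f(O)\le\widehat f(A)+\sum_{v\in O}\widehat f(v|A).$$
   Context: $\Omega$ is a finite ground set. For $A\in\mathbb{R}_+^\Omega$ (identified in the paper with the "valid" subset $\{(u,t):u\in\Omega,\ 0<t\le A_u\}$ of $\Omega\times\mathbb{R}_+$), $\mathsf{R}(A)\subseteq\Omega$ is the random set that includes each $u\in\Omega$ independently with probability $1-e^{ -A_u}$, and $\widehat f(A):=\mathbf{E}[f(\mathsf{R}(A))]$. For $u\in\Omega$, the marginal value is $\widehat f(u|A):=\lim_{t\to0^+}\frac{\widehat f(A\oplus(u,[t]))-\widehat f(A)}{t}$, where $A\oplus(u,[t])$ is the vector obtained from $A$ by increasing coordinate $u$ by $t$. -}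

module Defs where

open import Data.Bool.Base using (if_then_else_)
open import Data.Fin.Base using (Fin)
open import Data.Fin.Subset using (Subset; inside; outside; _⊆_; _∪_; _∩_)
open import Data.Fin.Subset.Properties using (_∈?_)
open import Data.Integer.Base as ℤ using (+_)
import Data.Integer.Properties as ℤₚ
open import Data.List.Base using (List; []; _∷_; map; foldr; allFin; filter; _++_)
open import Data.Nat.Base as ℕ using (ℕ; zero; suc)
import Data.Nat.Coprimality as Coprime
import Data.Nat.Properties as ℕₚ
open import Data.Product.Base using (∃; _×_; _,_; proj₁; proj₂)
open import Data.Rational.Base as ℚ using (ℚ; 0ℚ; 1ℚ; ½; mkℚ)
import Data.Rational.Properties as ℚₚ
import Data.Rational.Unnormalised.Base as ℚᵘ
import Data.Rational.Unnormalised.Properties as ℚᵘₚ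
open import Data.Rational.Solver using (module +-*-Solver)
open import Data.Sum.Base using (_⊎_; inj₁; inj₂)
open import Data.Vec.Base using ([]; _∷_)
open import Data.Vec.Functional using (Vector; updateAt)
open import Relation.Binary.PropositionalEquality
  using (_≡_; refl; sym; trans; cong; cong₂; subst)
open import Relation.Nullary.Decidable using (does)

-- Reals are Cauchy sequences of rationals.  Two sequences denote the same
-- real when x ≤ y and y ≤ x; the propositional equality of the record ℝ is
-- finer than that and is not used.

record IsCauchy (x : ℕ → ℚ) : Set where
  constructor isCauchy
  field
    modulus : ∀ ε → 0ℚ ℚ.< ε →
      ∃ λ N → ∀ m n → N ℕ.≤ m → N ℕ.≤ n → ℚ.∣ x m ℚ.- x n ∣ ℚ.< ε

open IsCauchy public

record ℝ : Set where
  constructor mkℝ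
  field
    seq    : ℕ → ℚ
    cauchy : IsCauchy seq

open ℝ public

infix 4 _≤_ _<_

record _≤_ (x y : ℝ) : Set where
  constructor mk≤
  field
    eventually : ∀ ε → 0ℚ ℚ.< ε →
      ∃ λ N → ∀ n → N ℕ.≤ n → seq x n ℚ.≤ seq y n ℚ.+ ε

record _<_ (x y : ℝ) : Set where
  constructor mk<
  field
    gap       : ℚ
    gap-pos   : 0ℚ ℚ.< gap
    start     : ℕ
    separated : ∀ n → start ℕ.≤ n → seq x n ℚ.+ gap ℚ.≤ seq y n

recip : ∀ c → 0ℚ ℚ.< c → ℚ
recip c 0<c = (ℚ.1/ c) {{ℚₚ.pos⇒nonZero c {{ℚ.positive 0<c}}}}

module CauchyLemmas where

  *-mono-≤ : ∀ {a b c d} → 0ℚ ℚ.≤ a → 0ℚ ℚ.≤ d → a ℚ.≤ b → c ℚ.≤ d →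
             a ℚ.* c ℚ.≤ b ℚ.* d
  *-mono-≤ {a} {b} {c} {d} 0≤a 0≤d a≤b c≤d = ℚₚ.≤-trans
    (ℚₚ.*-monoˡ-≤-nonNeg a {{ℚ.nonNegative 0≤a}} c≤d)
    (ℚₚ.*-monoʳ-≤-nonNeg d {{ℚ.nonNegative 0≤d}} a≤b)

  *-pos : ∀ {a b} → 0ℚ ℚ.< a → 0ℚ ℚ.< b → 0ℚ ℚ.< a ℚ.* b
  *-pos {a} {b} 0<a 0<b = ℚₚ.positive⁻¹ (a ℚ.* b)
    {{ℚₚ.pos*pos⇒pos a {{ℚ.positive 0<a}} b {{ℚ.positive 0<b}}}}

  0<1 : 0ℚ ℚ.< 1ℚ
  0<1 = ℚₚ.positive⁻¹ 1ℚ

  0<½ : 0ℚ ℚ.< ½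
  0<½ = ℚₚ.positive⁻¹ ½

  recip-pos : ∀ c (0<c : 0ℚ ℚ.< c) → 0ℚ ℚ.< recip c 0<c
  recip-pos c 0<c = ℚₚ.positive⁻¹ _ {{ℚₚ.1/pos⇒pos c {{ℚ.positive 0<c}}}}

  recip-inv : ∀ c (0<c : 0ℚ ℚ.< c) → c ℚ.* recip c 0<c ≡ 1ℚ
  recip-inv c 0<c = ℚₚ.*-inverseʳ c {{ℚₚ.pos⇒nonZero c {{ℚ.positive 0<c}}}}

  ∣∣-comm : ∀ p q → ℚ.∣ p ℚ.- q ∣ ≡ ℚ.∣ q ℚ.- p ∣
  ∣∣-comm p q = trans (cong ℚ.∣_∣ eq) (ℚₚ.∣-p∣≡∣p∣ (q ℚ.- p))
    where
    eq : p ℚ.- q ≡ ℚ.- (q ℚ.- p)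
    eq = solve 2 (λ a b → a :- b := :- (b :- a)) refl p q
      where open +-*-Solver

  p≤∣p∣ : ∀ p → p ℚ.≤ ℚ.∣ p ∣
  p≤∣p∣ p with ℚₚ.≤-total 0ℚ p
  ... | inj₁ 0≤p = ℚₚ.≤-reflexive (sym (ℚₚ.0≤p⇒∣p∣≡p 0≤p))
  ... | inj₂ p≤0 = ℚₚ.≤-trans p≤0 (ℚₚ.0≤∣p∣ p)

  ∣∣-lub : ∀ {p k} → p ℚ.≤ k → ℚ.- p ℚ.≤ k → ℚ.∣ p ∣ ℚ.≤ k
  ∣∣-lub {p} p≤k -p≤k with ℚₚ.∣p∣≡p∨∣p∣≡-p p
  ... | inj₁ e = ℚₚ.≤-trans (ℚₚ.≤-reflexive e) p≤k
  ... | inj₂ e = ℚₚ.≤-trans (ℚₚ.≤-reflexive e) -p≤k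

  ∣∣-bound : ∀ p q → ℚ.∣ p ∣ ℚ.≤ ℚ.∣ q ∣ ℚ.+ ℚ.∣ p ℚ.- q ∣
  ∣∣-bound p q = ℚₚ.≤-trans (ℚₚ.≤-reflexive (cong ℚ.∣_∣ eq))
                           (ℚₚ.∣p+q∣≤∣p∣+∣q∣ q (p ℚ.- q))
    where
    eq : p ≡ q ℚ.+ (p ℚ.- q)
    eq = solve 2 (λ a b → a := b :+ (a :- b)) refl p q
      where open +-*-Solver

  ≤+nonneg : ∀ {p q} → 0ℚ ℚ.≤ q → p ℚ.≤ p ℚ.+ q
  ≤+nonneg {p} {q} 0≤q = ℚₚ.≤-trans (ℚₚ.≤-reflexive (sym (ℚₚ.+-identityʳ p)))
                                    (ℚₚ.+-monoʳ-≤ p 0≤q)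

  nonneg+≤ : ∀ {p q} → 0ℚ ℚ.≤ q → p ℚ.≤ q ℚ.+ p
  nonneg+≤ {p} {q} 0≤q = ℚₚ.≤-trans (≤+nonneg 0≤q)
                                    (ℚₚ.≤-reflexive (ℚₚ.+-comm p q))

  controlled : ∀ {a b y : ℕ → ℚ} K → 0ℚ ℚ.< K → IsCauchy a → IsCauchy b →
    (∀ m n → ℚ.∣ y m ℚ.- y n ∣ ℚ.≤
             K ℚ.* (ℚ.∣ a m ℚ.- a n ∣ ℚ.+ ℚ.∣ b m ℚ.- b n ∣)) →
    IsCauchy y
  controlled {a} {b} {y} K 0<K ca cb bound = isCauchy λ ε 0<ε → go ε 0<ε
    where
    module _ (ε : ℚ) (0<ε : 0ℚ ℚ.< ε) where
      δ : ℚ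
      δ = ½ ℚ.* (ε ℚ.* recip K 0<K)
      0<δ : 0ℚ ℚ.< δ
      0<δ = *-pos 0<½ (*-pos 0<ε (recip-pos K 0<K))
      N = proj₁ (modulus ca δ 0<δ) ℕ.⊔ proj₁ (modulus cb δ 0<δ)
      eq : K ℚ.* (δ ℚ.+ δ) ≡ ε
      eq = trans (solve 3 (λ k e r → k :* (con ½ :* (e :* r) :+ con ½ :* (e :* r))
                                     := (k :* r) :* e) refl K ε (recip K 0<K))
          (trans (cong (ℚ._* ε) (recip-inv K 0<K)) (ℚₚ.*-identityˡ ε))
        where open +-*-Solver
      close : ∀ m n → N ℕ.≤ m → N ℕ.≤ n → ℚ.∣ y m ℚ.- y n ∣ ℚ.< ε
      close m n N≤m N≤n = ℚₚ.≤-<-trans (bound m n) (subst (_ ℚ.<_) eq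
        (ℚₚ.*-monoʳ-<-pos K {{ℚ.positive 0<K}} (ℚₚ.+-mono-<
          (proj₂ (modulus ca δ 0<δ) m n (ℕₚ.m⊔n≤o⇒m≤o _ _ N≤m) (ℕₚ.m⊔n≤o⇒m≤o _ _ N≤n))
          (proj₂ (modulus cb δ 0<δ) m n (ℕₚ.m⊔n≤o⇒n≤o _ _ N≤m) (ℕₚ.m⊔n≤o⇒n≤o _ _ N≤n)))))
      go : ∃ λ N → ∀ m n → N ℕ.≤ m → N ℕ.≤ n → ℚ.∣ y m ℚ.- y n ∣ ℚ.< ε
      go = N , close

  lipschitz : ∀ {a y : ℕ → ℚ} K → 0ℚ ℚ.< K → IsCauchy a →
    (∀ m n → ℚ.∣ y m ℚ.- y n ∣ ℚ.≤ K ℚ.* ℚ.∣ a m ℚ.- a n ∣) → IsCauchy y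
  lipschitz {a} K 0<K ca bound = controlled K 0<K ca ca λ m n →
    ℚₚ.≤-trans (bound m n)
      (ℚₚ.*-monoˡ-≤-nonNeg K {{ℚ.nonNegative (ℚₚ.<⇒≤ 0<K)}}
        (≤+nonneg (ℚₚ.0≤∣p∣ (a m ℚ.- a n))))

  1-lipschitz : ∀ {a y : ℕ → ℚ} → IsCauchy a →
    (∀ m n → ℚ.∣ y m ℚ.- y n ∣ ℚ.≤ ℚ.∣ a m ℚ.- a n ∣) → IsCauchy y
  1-lipschitz ca bound = lipschitz 1ℚ 0<1 ca λ m n →
    ℚₚ.≤-trans (bound m n) (ℚₚ.≤-reflexive (sym (ℚₚ.*-identityˡ _)))

  const-cauchy : ∀ q → IsCauchy (λ _ → q)
  const-cauchy q = isCauchy λ ε 0<ε → 0 , λ _ _ _ _ →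
    subst (ℚ._< ε) (sym (cong ℚ.∣_∣ (ℚₚ.+-inverseʳ q))) 0<ε

  +-cauchy : ∀ {a b} → IsCauchy a → IsCauchy b → IsCauchy (λ n → a n ℚ.+ b n)
  +-cauchy {a} {b} ca cb = controlled 1ℚ 0<1 ca cb λ m n →
    ℚₚ.≤-trans (ℚₚ.≤-reflexive (cong ℚ.∣_∣ (eq (a m) (b m) (a n) (b n))))
   (ℚₚ.≤-trans (ℚₚ.∣p+q∣≤∣p∣+∣q∣ (a m ℚ.- a n) (b m ℚ.- b n))
               (ℚₚ.≤-reflexive (sym (ℚₚ.*-identityˡ _))))
    where
    eq : ∀ p q r s → (p ℚ.+ q) ℚ.- (r ℚ.+ s) ≡ (p ℚ.- r) ℚ.+ (q ℚ.- s)
    eq = solve 4 (λ p q r s → (p :+ q) :- (r :+ s) := (p :- r) :+ (q :- s)) refl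
      where open +-*-Solver

  neg-cauchy : ∀ {a} → IsCauchy a → IsCauchy (λ n → ℚ.- a n)
  neg-cauchy {a} ca = 1-lipschitz ca λ m n → ℚₚ.≤-reflexive
    (trans (cong ℚ.∣_∣ (eq (a m) (a n))) (∣∣-comm (a n) (a m)))
    where
    eq : ∀ p q → (ℚ.- p) ℚ.- (ℚ.- q) ≡ q ℚ.- p
    eq = solve 2 (λ p q → (:- p) :- (:- q) := q :- p) refl
      where open +-*-Solver

  abs-cauchy : ∀ {a} → IsCauchy a → IsCauchy (λ n → ℚ.∣ a n ∣)
  abs-cauchy {a} ca = 1-lipschitz ca λ m n → ∣∣-lub
    (shift (∣∣-bound (a m) (a n)))
    (ℚₚ.≤-trans (ℚₚ.≤-reflexive (eq ℚ.∣ a m ∣ ℚ.∣ a n ∣))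
    (ℚₚ.≤-trans (shift (∣∣-bound (a n) (a m)))
                (ℚₚ.≤-reflexive (∣∣-comm (a n) (a m)))))
    where
    eq : ∀ p q → ℚ.- (p ℚ.- q) ≡ q ℚ.- p
    eq = solve 2 (λ p q → :- (p :- q) := q :- p) refl
      where open +-*-Solver
    shift : ∀ {p q r} → p ℚ.≤ q ℚ.+ r → p ℚ.- q ℚ.≤ r
    shift {p} {q} {r} h = ℚₚ.≤-trans (ℚₚ.+-monoˡ-≤ (ℚ.- q) h)
      (ℚₚ.≤-reflexive (solve 2 (λ q r → (q :+ r) :- q := r) refl q r))
      where open +-*-Solver

  prefix-bound : ∀ (x : ℕ → ℚ) N →
    ∃ λ M → 0ℚ ℚ.≤ M × (∀ n → n ℕ.< N → ℚ.∣ x n ∣ ℚ.≤ M)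
  prefix-bound x zero = 0ℚ , ℚₚ.≤-refl , λ _ ()
  prefix-bound x (suc N) with prefix-bound x N
  ... | M , 0≤M , h = M ℚ.⊔ ℚ.∣ x N ∣ , ℚₚ.≤-trans 0≤M (ℚₚ.p≤p⊔q M _) , g
    where
    g : ∀ n → n ℕ.< suc N → ℚ.∣ x n ∣ ℚ.≤ M ℚ.⊔ ℚ.∣ x N ∣
    g n n<1+N with ℕₚ.m≤n⇒m<n∨m≡n (ℕ.s≤s⁻¹ n<1+N)
    ... | inj₁ n<N  = ℚₚ.≤-trans (h n n<N) (ℚₚ.p≤p⊔q M _)
    ... | inj₂ refl = ℚₚ.p≤q⊔p M _

  bounded : ∀ {x} → IsCauchy x → ∃ λ M → 0ℚ ℚ.< M × (∀ n → ℚ.∣ x n ∣ ℚ.≤ M)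
  bounded {x} cx with modulus cx 1ℚ 0<1
  ... | N , h with prefix-bound x N
  ... | P , 0≤P , pre = M , 0<M , all
    where
    M = (P ℚ.+ ℚ.∣ x N ∣) ℚ.+ 1ℚ
    0≤P+ : 0ℚ ℚ.≤ P ℚ.+ ℚ.∣ x N ∣
    0≤P+ = ℚₚ.≤-trans 0≤P (≤+nonneg (ℚₚ.0≤∣p∣ (x N)))
    0<M : 0ℚ ℚ.< M
    0<M = ℚₚ.<-≤-trans 0<1 (nonneg+≤ 0≤P+)
    all : ∀ n → ℚ.∣ x n ∣ ℚ.≤ M
    all n with ℕₚ.<-≤-connex n N
    ... | inj₁ n<N = ℚₚ.≤-trans (pre n n<N)
                    (ℚₚ.≤-trans (≤+nonneg (ℚₚ.0≤∣p∣ (x N)))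
                                (≤+nonneg (ℚₚ.<⇒≤ 0<1)))
    ... | inj₂ N≤n = ℚₚ.≤-trans (∣∣-bound (x n) (x N))
                      (ℚₚ.+-mono-≤ (nonneg+≤ 0≤P)
                        (ℚₚ.<⇒≤ (h n N N≤n ℕₚ.≤-refl)))

  *-cauchy : ∀ {a b} → IsCauchy a → IsCauchy b → IsCauchy (λ n → a n ℚ.* b n)
  *-cauchy {a} {b} ca cb with bounded ca | bounded cb
  ... | A , 0<A , a≤A | B , 0<B , b≤B = controlled K 0<K ca cb bound
    where
    K = A ℚ.+ B
    0<K : 0ℚ ℚ.< K
    0<K = ℚₚ.<-≤-trans 0<A (≤+nonneg (ℚₚ.<⇒≤ 0<B))
    0≤K = ℚₚ.<⇒≤ 0<K
    eq : ∀ p q r s → p ℚ.* q ℚ.- r ℚ.* s ≡ (p ℚ.- r) ℚ.* q ℚ.+ r ℚ.* (q ℚ.- s)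
    eq = solve 4 (λ p q r s → p :* q :- r :* s := (p :- r) :* q :+ r :* (q :- s)) refl
      where open +-*-Solver
    bound : ∀ m n → ℚ.∣ a m ℚ.* b m ℚ.- a n ℚ.* b n ∣ ℚ.≤
                    K ℚ.* (ℚ.∣ a m ℚ.- a n ∣ ℚ.+ ℚ.∣ b m ℚ.- b n ∣)
    bound m n = begin
      ℚ.∣ a m ℚ.* b m ℚ.- a n ℚ.* b n ∣
        ≡⟨ cong ℚ.∣_∣ (eq (a m) (b m) (a n) (b n)) ⟩
      ℚ.∣ (a m ℚ.- a n) ℚ.* b m ℚ.+ a n ℚ.* (b m ℚ.- b n) ∣
        ≤⟨ ℚₚ.∣p+q∣≤∣p∣+∣q∣ ((a m ℚ.- a n) ℚ.* b m) (a n ℚ.* (b m ℚ.- b n)) ⟩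
      ℚ.∣ (a m ℚ.- a n) ℚ.* b m ∣ ℚ.+ ℚ.∣ a n ℚ.* (b m ℚ.- b n) ∣
        ≡⟨ cong₂ ℚ._+_ (ℚₚ.∣p*q∣≡∣p∣*∣q∣ (a m ℚ.- a n) (b m))
                       (ℚₚ.∣p*q∣≡∣p∣*∣q∣ (a n) (b m ℚ.- b n)) ⟩
      ℚ.∣ a m ℚ.- a n ∣ ℚ.* ℚ.∣ b m ∣ ℚ.+ ℚ.∣ a n ∣ ℚ.* ℚ.∣ b m ℚ.- b n ∣
        ≤⟨ ℚₚ.+-mono-≤
             (*-mono-≤ (ℚₚ.0≤∣p∣ (a m ℚ.- a n)) 0≤K ℚₚ.≤-refl
               (ℚₚ.≤-trans (b≤B m) (nonneg+≤ (ℚₚ.<⇒≤ 0<A))))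
             (*-mono-≤ (ℚₚ.0≤∣p∣ (a n)) (ℚₚ.0≤∣p∣ (b m ℚ.- b n))
               (ℚₚ.≤-trans (a≤A n) (≤+nonneg (ℚₚ.<⇒≤ 0<B))) ℚₚ.≤-refl) ⟩
      ℚ.∣ a m ℚ.- a n ∣ ℚ.* K ℚ.+ K ℚ.* ℚ.∣ b m ℚ.- b n ∣
        ≡⟨ solve 3 (λ u v k → u :* k :+ k :* v := k :* (u :+ v)) refl
             ℚ.∣ a m ℚ.- a n ∣ ℚ.∣ b m ℚ.- b n ∣ K ⟩
      K ℚ.* (ℚ.∣ a m ℚ.- a n ∣ ℚ.+ ℚ.∣ b m ℚ.- b n ∣) ∎
      where
      open ℚₚ.≤-Reasoning
      open +-*-Solver

  recip-anti : ∀ {c a} (0<c : 0ℚ ℚ.< c) (0<a : 0ℚ ℚ.< a) → c ℚ.≤ a →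
               recip a 0<a ℚ.≤ recip c 0<c
  recip-anti {c} {a} 0<c 0<a c≤a = begin
    ra               ≡⟨ sym (ℚₚ.*-identityʳ ra) ⟩
    ra ℚ.* 1ℚ        ≡⟨ cong (ra ℚ.*_) (sym (recip-inv c 0<c)) ⟩
    ra ℚ.* (c ℚ.* rc)
      ≤⟨ *-mono-≤ (ℚₚ.<⇒≤ (recip-pos a 0<a))
           (ℚₚ.<⇒≤ (*-pos 0<a (recip-pos c 0<c))) ℚₚ.≤-refl
           (*-mono-≤ (ℚₚ.<⇒≤ 0<c) (ℚₚ.<⇒≤ (recip-pos c 0<c)) c≤a ℚₚ.≤-refl) ⟩
    ra ℚ.* (a ℚ.* rc)
      ≡⟨ solve 3 (λ x y z → x :* (y :* z) := (y :* x) :* z) refl ra a rc ⟩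
    (a ℚ.* ra) ℚ.* rc ≡⟨ cong (ℚ._* rc) (recip-inv a 0<a) ⟩
    1ℚ ℚ.* rc        ≡⟨ ℚₚ.*-identityˡ rc ⟩
    rc ∎
    where
    open ℚₚ.≤-Reasoning
    open +-*-Solver
    ra = recip a 0<a
    rc = recip c 0<c

  max-pos : ∀ {c} → 0ℚ ℚ.< c → ∀ p → 0ℚ ℚ.< c ℚ.⊔ p
  max-pos {c} 0<c p = ℚₚ.<-≤-trans 0<c (ℚₚ.p≤p⊔q c p)

  max-≤ : ∀ c p q → (c ℚ.⊔ p) ℚ.- (c ℚ.⊔ q) ℚ.≤ ℚ.∣ p ℚ.- q ∣
  max-≤ c p q = ℚₚ.≤-trans (ℚₚ.+-monoˡ-≤ (ℚ.- (c ℚ.⊔ q)) lub)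
    (ℚₚ.≤-reflexive (solve 2 (λ m d → (m :+ d) :- m := d) refl (c ℚ.⊔ q) ℚ.∣ p ℚ.- q ∣))
    where
    open +-*-Solver
    lub : c ℚ.⊔ p ℚ.≤ (c ℚ.⊔ q) ℚ.+ ℚ.∣ p ℚ.- q ∣
    lub = ℚₚ.⊔-lub
      (ℚₚ.≤-trans (ℚₚ.p≤p⊔q c q) (≤+nonneg (ℚₚ.0≤∣p∣ (p ℚ.- q))))
      (ℚₚ.≤-trans (ℚₚ.≤-reflexive (solve 2 (λ p q → p := q :+ (p :- q)) refl p q))
        (ℚₚ.+-mono-≤ (ℚₚ.p≤q⊔p c q) (p≤∣p∣ (p ℚ.- q))))

  max-lipschitz : ∀ c p q → ℚ.∣ (c ℚ.⊔ p) ℚ.- (c ℚ.⊔ q) ∣ ℚ.≤ ℚ.∣ p ℚ.- q ∣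
  max-lipschitz c p q = ∣∣-lub (max-≤ c p q)
    (ℚₚ.≤-trans (ℚₚ.≤-reflexive (solve 2 (λ a b → :- (a :- b) := b :- a) refl (c ℚ.⊔ p) (c ℚ.⊔ q)))
    (ℚₚ.≤-trans (max-≤ c q p) (ℚₚ.≤-reflexive (∣∣-comm q p))))
    where open +-*-Solver

  recip-diff : ∀ a b (0<a : 0ℚ ℚ.< a) (0<b : 0ℚ ℚ.< b) →
    recip a 0<a ℚ.- recip b 0<b ≡ (recip a 0<a ℚ.* recip b 0<b) ℚ.* (b ℚ.- a)
  recip-diff a b 0<a 0<b = sym (trans
    (solve 4 (λ a b x y → (x :* y) :* (b :- a) := x :* (b :* y) :- (a :* x) :* y) refl a b ra rb)
    (cong₂ ℚ._-_ (trans (cong (ra ℚ.*_) (recip-inv b 0<b)) (ℚₚ.*-identityʳ ra))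
                 (trans (cong (ℚ._* rb) (recip-inv a 0<a)) (ℚₚ.*-identityˡ rb))))
    where
    open +-*-Solver
    ra = recip a 0<a
    rb = recip b 0<b

  recip-cauchy : ∀ {x} c (0<c : 0ℚ ℚ.< c) → IsCauchy x →
    IsCauchy (λ n → recip (c ℚ.⊔ x n) (max-pos 0<c (x n)))
  recip-cauchy {x} c 0<c cx = lipschitz (rc ℚ.* rc) (*-pos 0<rc 0<rc) cx bound
    where
    rc = recip c 0<c
    0<rc = recip-pos c 0<c
    r : ℕ → ℚ
    r n = recip (c ℚ.⊔ x n) (max-pos 0<c (x n))
    0≤r : ∀ n → 0ℚ ℚ.≤ r n
    0≤r n = ℚₚ.<⇒≤ (recip-pos (c ℚ.⊔ x n) (max-pos 0<c (x n)))
    r≤rc : ∀ n → r n ℚ.≤ rc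
    r≤rc n = recip-anti 0<c (max-pos 0<c (x n)) (ℚₚ.p≤p⊔q c (x n))
    bound : ∀ m n → ℚ.∣ r m ℚ.- r n ∣ ℚ.≤ (rc ℚ.* rc) ℚ.* ℚ.∣ x m ℚ.- x n ∣
    bound m n = begin
      ℚ.∣ r m ℚ.- r n ∣
        ≡⟨ cong ℚ.∣_∣ (recip-diff (c ℚ.⊔ x m) (c ℚ.⊔ x n) (max-pos 0<c (x m)) (max-pos 0<c (x n))) ⟩
      ℚ.∣ (r m ℚ.* r n) ℚ.* d ∣
        ≡⟨ ℚₚ.∣p*q∣≡∣p∣*∣q∣ (r m ℚ.* r n) d ⟩
      ℚ.∣ r m ℚ.* r n ∣ ℚ.* ℚ.∣ d ∣
        ≡⟨ cong (ℚ._* ℚ.∣ d ∣) (ℚₚ.0≤p⇒∣p∣≡p 0≤rr) ⟩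
      (r m ℚ.* r n) ℚ.* ℚ.∣ d ∣
        ≤⟨ *-mono-≤ 0≤rr (ℚₚ.0≤∣p∣ (x m ℚ.- x n))
             (*-mono-≤ (0≤r m) (ℚₚ.<⇒≤ 0<rc) (r≤rc m) (r≤rc n))
             (ℚₚ.≤-trans (max-lipschitz c (x n) (x m))
                         (ℚₚ.≤-reflexive (∣∣-comm (x n) (x m)))) ⟩
      (rc ℚ.* rc) ℚ.* ℚ.∣ x m ℚ.- x n ∣ ∎
      where
      open ℚₚ.≤-Reasoning
      d = (c ℚ.⊔ x n) ℚ.- (c ℚ.⊔ x m)
      0≤rr : 0ℚ ℚ.≤ r m ℚ.* r n
      0≤rr = ℚₚ.≤-trans (ℚₚ.≤-reflexive (sym (ℚₚ.*-zeroˡ 0ℚ)))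
               (*-mono-≤ ℚₚ.≤-refl (0≤r n) (0≤r m) (0≤r n))

open CauchyLemmas

infix  8 -_
infixl 7 _*_
infixl 6 _+_ _-_

fromℚ : ℚ → ℝ
fromℚ q = mkℝ (λ _ → q) (const-cauchy q)

0ℝ 1ℝ : ℝ
0ℝ = fromℚ 0ℚ
1ℝ = fromℚ 1ℚ

_+_ _*_ : ℝ → ℝ → ℝ
x + y = mkℝ (λ n → seq x n ℚ.+ seq y n) (+-cauchy (cauchy x) (cauchy y))
x * y = mkℝ (λ n → seq x n ℚ.* seq y n) (*-cauchy (cauchy x) (cauchy y))

-_ : ℝ → ℝ
- x = mkℝ (λ n → ℚ.- seq x n) (neg-cauchy (cauchy x))

_-_ : ℝ → ℝ → ℝ
x - y = x + (- y)

∣_∣ : ℝ → ℝ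
∣ x ∣ = mkℝ (λ n → ℚ.∣ seq x n ∣) (abs-cauchy (cauchy x))

-- The gap c in 0 < x is eventually a lower bound of the sequence, so
-- c ⊔ seq x n is eventually seq x n; the maximum only removes possible
-- zeros at the start.
inv : ∀ x → 0ℝ < x → ℝ
inv x (mk< c 0<c _ _) =
  mkℝ (λ n → recip (c ℚ.⊔ seq x n) (max-pos 0<c (seq x n)))
      (recip-cauchy c 0<c (cauchy x))

-- q ^ k / k !
expTerm : ℚ → ℕ → ℚ
expTerm q zero    = 1ℚ
expTerm q (suc k) = expTerm q k ℚ.* (q ℚ.* (+ 1 ℚ./ suc k))

expSum : ℚ → ℕ → ℚ
expSum q zero    = 0ℚ
expSum q (suc n) = expSum q n ℚ.+ expTerm q n

module ExpLemmas where

  expTerm-cauchy : ∀ {x} → IsCauchy x → ∀ k → IsCauchy (λ n → expTerm (x n) k)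
  expTerm-cauchy cx zero    = const-cauchy 1ℚ
  expTerm-cauchy cx (suc k) = *-cauchy (expTerm-cauchy cx k)
                                       (*-cauchy cx (const-cauchy (+ 1 ℚ./ suc k)))

  expSum-cauchy : ∀ {x} → IsCauchy x → ∀ k → IsCauchy (λ n → expSum (x n) k)
  expSum-cauchy cx zero    = const-cauchy 0ℚ
  expSum-cauchy cx (suc k) = +-cauchy (expSum-cauchy cx k) (expTerm-cauchy cx k)

  ι : ℕ → ℚ
  ι n = mkℚ (+ n) 0 (Coprime.sym (Coprime.1-coprimeTo n))

  archimedean : ∀ p → p ℚ.≤ ι ℤ.∣ ℚ.↥ p ∣
  archimedean p = ℚ.*≤* (ℤₚ.≤-trans (ℤₚ.≤-reflexive (ℤₚ.*-identityʳ (ℚ.↥ p)))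
    (ℤₚ.≤-trans (i≤∣i∣ (ℚ.↥ p)) (subst (ℤ._≤ + ℤ.∣ ℚ.↥ p ∣ ℤ.* ℚ.↧ p)
      (ℤₚ.*-identityʳ (+ ℤ.∣ ℚ.↥ p ∣))
      (ℤₚ.*-monoˡ-≤-nonNeg (+ ℤ.∣ ℚ.↥ p ∣) (ℤ.+≤+ (ℕ.s≤s ℕ.z≤n))))))
    where
    i≤∣i∣ : ∀ i → i ℤ.≤ + ℤ.∣ i ∣
    i≤∣i∣ (+ n)       = ℤₚ.≤-refl
    i≤∣i∣ ℤ.-[1+ n ] = ℤ.-≤+

  ι-mono : ∀ {m n} → m ℕ.≤ n → ι m ℚ.≤ ι n
  ι-mono {m} {n} m≤n = ℚ.*≤* (ℤₚ.*-monoʳ-≤-nonNeg (+ 1) (ℤ.+≤+ m≤n))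

  ι-suc : ∀ n → ι (suc n) ≡ 1ℚ ℚ.+ ι n
  ι-suc n = ℚₚ.toℚᵘ-injective (ℚᵘₚ.≃-trans (ℚᵘ.*≡* eq)
              (ℚᵘₚ.≃-sym (ℚₚ.toℚᵘ-homo-+ 1ℚ (ι n))))
    where
    eq : + suc n ℤ.* + 1 ≡ (+ 1 ℤ.* + 1 ℤ.+ + n ℤ.* + 1) ℤ.* + 1
    eq = cong (ℤ._* + 1) (cong (ℤ._+_ (+ 1)) (sym (ℤₚ.*-identityʳ (+ n))))

  ι-inv : ∀ k → ι (suc k) ℚ.* (+ 1 ℚ./ suc k) ≡ 1ℚ
  ι-inv k = ℚₚ.toℚᵘ-injective (ℚᵘₚ.≃-trans (ℚₚ.toℚᵘ-homo-* (ι (suc k)) (+ 1 ℚ./ suc k))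
    (ℚᵘₚ.≃-trans (ℚᵘₚ.*-congˡ {ℚ.toℚᵘ (ι (suc k))} (ℚₚ.toℚᵘ-fromℚᵘ (ℚᵘ.mkℚᵘ (+ 1) k)))
      (ℚᵘ.*≡* (trans (ℤₚ.*-identityʳ (+ suc k ℤ.* + 1))
        (trans (ℤₚ.*-identityʳ (+ suc k)) (sym (trans (ℤₚ.*-identityˡ _) (ℤₚ.*-identityˡ (+ suc k)))))))))

  0≤1/ : ∀ k → 0ℚ ℚ.≤ + 1 ℚ./ suc k
  0≤1/ k = ℚₚ.nonNegative⁻¹ _ {{ℚₚ.normalize-nonNeg 1 (suc k)}}

  ratio : ∀ {M q} K → 0ℚ ℚ.≤ M → ℚ.∣ q ∣ ℚ.≤ M → M ℚ.+ M ℚ.≤ ι K → ∀ k → K ℕ.≤ k →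
    ℚ.∣ q ℚ.* (+ 1 ℚ./ suc k) ∣ ℚ.≤ ½
  ratio {M} {q} K 0≤M q≤M M≤K k K≤k = begin
    ℚ.∣ q ℚ.* r ∣           ≡⟨ ℚₚ.∣p*q∣≡∣p∣*∣q∣ q r ⟩
    ℚ.∣ q ∣ ℚ.* ℚ.∣ r ∣     ≡⟨ cong (ℚ.∣ q ∣ ℚ.*_) (ℚₚ.0≤p⇒∣p∣≡p (0≤1/ k)) ⟩
    ℚ.∣ q ∣ ℚ.* r           ≤⟨ *-mono-≤ (ℚₚ.0≤∣p∣ q) (0≤1/ k) q≤M ℚₚ.≤-refl ⟩
    M ℚ.* r
      ≡⟨ solve 2 (λ m s → m :* s := con ½ :* ((m :+ m) :* s)) refl M r ⟩
    ½ ℚ.* ((M ℚ.+ M) ℚ.* r)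
      ≤⟨ ℚₚ.*-monoˡ-≤-nonNeg ½ (ℚₚ.*-monoʳ-≤-nonNeg r {{ℚ.nonNegative (0≤1/ k)}}
           (ℚₚ.≤-trans M≤K (ι-mono (ℕₚ.m≤n⇒m≤1+n K≤k)))) ⟩
    ½ ℚ.* (ι (suc k) ℚ.* r) ≡⟨ cong (½ ℚ.*_) (ι-inv k) ⟩
    ½ ℚ.* 1ℚ                ≡⟨ ℚₚ.*-identityʳ ½ ⟩
    ½ ∎
    where
    open ℚₚ.≤-Reasoning
    open +-*-Solver
    r = + 1 ℚ./ suc k

  halves : ℚ → ℕ → ℚ
  halves B zero    = B
  halves B (suc j) = halves B j ℚ.* ½

  halves-nonneg : ∀ {B} → 0ℚ ℚ.≤ B → ∀ j → 0ℚ ℚ.≤ halves B j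
  halves-nonneg 0≤B zero    = 0≤B
  halves-nonneg 0≤B (suc j) = ℚₚ.≤-trans (ℚₚ.≤-reflexive (sym (ℚₚ.*-zeroˡ ½)))
    (ℚₚ.*-monoʳ-≤-nonNeg ½ (halves-nonneg 0≤B j))

  halves-small : ∀ {B} → 0ℚ ℚ.≤ B → ∀ j → halves B j ℚ.* ι (suc j) ℚ.≤ B
  halves-small {B} 0≤B zero    = ℚₚ.≤-reflexive (ℚₚ.*-identityʳ B)
  halves-small {B} 0≤B (suc j) = begin
    (h ℚ.* ½) ℚ.* ι (suc (suc j))
      ≡⟨ cong ((h ℚ.* ½) ℚ.*_) (ι-suc (suc j)) ⟩
    (h ℚ.* ½) ℚ.* (1ℚ ℚ.+ ι (suc j))
      ≤⟨ *-mono-≤ 0≤h½ 0≤ss ℚₚ.≤-refl (ℚₚ.+-monoˡ-≤ (ι (suc j)) (ι-mono {1} {suc j} (ℕ.s≤s ℕ.z≤n))) ⟩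
    (h ℚ.* ½) ℚ.* (ι (suc j) ℚ.+ ι (suc j))
      ≡⟨ solve 2 (λ a b → (a :* con ½) :* (b :+ b) := a :* b) refl h (ι (suc j)) ⟩
    h ℚ.* ι (suc j)
      ≤⟨ halves-small 0≤B j ⟩
    B ∎
    where
    open ℚₚ.≤-Reasoning
    open +-*-Solver
    h = halves B j
    0≤h½ = halves-nonneg 0≤B (suc j)
    0≤s : 0ℚ ℚ.≤ ι (suc j)
    0≤s = ι-mono ℕ.z≤n
    0≤ss : 0ℚ ℚ.≤ ι (suc j) ℚ.+ ι (suc j)
    0≤ss = ℚₚ.≤-trans 0≤s (≤+nonneg 0≤s)

  halves→0 : ∀ {B} → 0ℚ ℚ.≤ B → ∀ ε → 0ℚ ℚ.< ε → ∃ λ j → halves B j ℚ.≤ ε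
  halves→0 {B} 0≤B ε 0<ε = j , ℚₚ.*-cancelʳ-≤-pos (ι (suc j)) (begin
    halves B j ℚ.* ι (suc j)  ≤⟨ halves-small 0≤B j ⟩
    B                         ≡⟨ sym (ℚₚ.*-identityˡ B) ⟩
    1ℚ ℚ.* B                  ≡⟨ cong (ℚ._* B) (sym (recip-inv ε 0<ε)) ⟩
    (ε ℚ.* r) ℚ.* B           ≡⟨ solve 3 (λ e r b → (e :* r) :* b := e :* (b :* r)) refl ε r B ⟩
    ε ℚ.* (B ℚ.* r)           ≤⟨ ℚₚ.*-monoˡ-≤-nonNeg ε {{ℚ.nonNegative (ℚₚ.<⇒≤ 0<ε)}}
                                  (ℚₚ.≤-trans (archimedean (B ℚ.* r)) (ι-mono (ℕₚ.n≤1+n j))) ⟩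
    ε ℚ.* ι (suc j) ∎)
    where
    open ℚₚ.≤-Reasoning
    open +-*-Solver
    r = recip ε 0<ε
    j = ℤ.∣ ℚ.↥ (B ℚ.* r) ∣

  tail-bound : ∀ {M q} K B → 0ℚ ℚ.≤ M → ℚ.∣ q ∣ ℚ.≤ M → M ℚ.+ M ℚ.≤ ι K → 0ℚ ℚ.≤ B →
    ℚ.∣ expTerm q K ∣ ℚ.≤ B →
    ∀ j i → ℚ.∣ expSum q (i ℕ.+ (j ℕ.+ K)) ℚ.- expSum q (j ℕ.+ K) ∣ ℚ.≤
            halves B j ℚ.+ halves B j
  tail-bound {M} {q} K B 0≤M q≤M M≤K 0≤B tK j i =
    ℚₚ.≤-trans (≤+nonneg (ℚₚ.≤-trans (0≤h (i ℕ.+ j)) (≤+nonneg (0≤h (i ℕ.+ j))))) (go i)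
    where
    0≤h = halves-nonneg 0≤B
    term : ∀ j → ℚ.∣ expTerm q (j ℕ.+ K) ∣ ℚ.≤ halves B j
    term zero    = tK
    term (suc j) = ℚₚ.≤-trans
      (ℚₚ.≤-reflexive (ℚₚ.∣p*q∣≡∣p∣*∣q∣ (expTerm q (j ℕ.+ K)) (q ℚ.* (+ 1 ℚ./ suc (j ℕ.+ K)))))
      (*-mono-≤ (ℚₚ.0≤∣p∣ (expTerm q (j ℕ.+ K))) (ℚₚ.<⇒≤ 0<½) (term j)
        (ratio {M} {q} K 0≤M q≤M M≤K (j ℕ.+ K) (ℕₚ.m≤n+m K j)))
    E = expSum q (j ℕ.+ K)
    go : ∀ i → ℚ.∣ expSum q (i ℕ.+ (j ℕ.+ K)) ℚ.- E ∣
               ℚ.+ (halves B (i ℕ.+ j) ℚ.+ halves B (i ℕ.+ j)) ℚ.≤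
               halves B j ℚ.+ halves B j
    go zero = ℚₚ.≤-reflexive (trans
      (cong (ℚ._+ (halves B j ℚ.+ halves B j)) (cong ℚ.∣_∣ (ℚₚ.+-inverseʳ E)))
      (ℚₚ.+-identityˡ _))
    go (suc i) = begin
      ℚ.∣ (S ℚ.+ t) ℚ.- E ∣ ℚ.+ (h ℚ.* ½ ℚ.+ h ℚ.* ½)
        ≡⟨ cong₂ ℚ._+_ (cong ℚ.∣_∣ (solve 3 (λ s t e → (s :+ t) :- e := (s :- e) :+ t) refl S t E))
                       (solve 1 (λ h → h :* con ½ :+ h :* con ½ := h) refl h) ⟩
      ℚ.∣ (S ℚ.- E) ℚ.+ t ∣ ℚ.+ h
        ≤⟨ ℚₚ.+-monoˡ-≤ h (ℚₚ.≤-trans (ℚₚ.∣p+q∣≤∣p∣+∣q∣ (S ℚ.- E) t)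
             (ℚₚ.+-monoʳ-≤ ℚ.∣ S ℚ.- E ∣ t≤h)) ⟩
      (ℚ.∣ S ℚ.- E ∣ ℚ.+ h) ℚ.+ h
        ≡⟨ ℚₚ.+-assoc ℚ.∣ S ℚ.- E ∣ h h ⟩
      ℚ.∣ S ℚ.- E ∣ ℚ.+ (h ℚ.+ h)
        ≤⟨ go i ⟩
      halves B j ℚ.+ halves B j ∎
      where
      open ℚₚ.≤-Reasoning
      open +-*-Solver
      S = expSum q (i ℕ.+ (j ℕ.+ K))
      t = expTerm q (i ℕ.+ (j ℕ.+ K))
      h = halves B (i ℕ.+ j)
      t≤h : ℚ.∣ t ∣ ℚ.≤ h
      t≤h = subst (λ k → ℚ.∣ expTerm q k ∣ ℚ.≤ h) (ℕₚ.+-assoc i j K) (term (i ℕ.+ j))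

  exp-cauchy : ∀ {x} → IsCauchy x → IsCauchy (λ n → expSum (x n) n)
  exp-cauchy {x} cx with bounded cx
  ... | M , 0<M , x≤M = isCauchy λ ε 0<ε → go ε 0<ε
    where
    module _ (ε : ℚ) (0<ε : 0ℚ ℚ.< ε) where
      K = ℤ.∣ ℚ.↥ (M ℚ.+ M) ∣
      Bs = bounded (expTerm-cauchy cx K)
      B = proj₁ Bs
      0≤B : 0ℚ ℚ.≤ B
      0≤B = ℚₚ.<⇒≤ (proj₁ (proj₂ Bs))
      δ = (½ ℚ.* ½) ℚ.* (½ ℚ.* ε)
      0<½ε : 0ℚ ℚ.< ½ ℚ.* ε
      0<½ε = *-pos 0<½ 0<ε
      small = halves→0 0≤B δ (*-pos (*-pos 0<½ 0<½) 0<½ε)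
      j = proj₁ small
      L = j ℕ.+ K
      h = halves B j
      fixed = modulus (expSum-cauchy cx L) (½ ℚ.* ε) 0<½ε
      N = L ℕ.⊔ proj₁ fixed
      tail : ∀ m → L ℕ.≤ m → ℚ.∣ expSum (x m) m ℚ.- expSum (x m) L ∣ ℚ.≤ δ ℚ.+ δ
      tail m L≤m = ℚₚ.≤-trans
        (subst (λ k → ℚ.∣ expSum (x m) k ℚ.- expSum (x m) L ∣ ℚ.≤ h ℚ.+ h)
          (ℕₚ.m∸n+n≡m L≤m)
          (tail-bound K B (ℚₚ.<⇒≤ 0<M) (x≤M m) (archimedean (M ℚ.+ M)) 0≤B
            (proj₂ (proj₂ Bs) m) j (m ℕ.∸ L)))
        (ℚₚ.+-mono-≤ (proj₂ small) (proj₂ small))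
      close : ∀ m n → N ℕ.≤ m → N ℕ.≤ n →
              ℚ.∣ expSum (x m) m ℚ.- expSum (x n) n ∣ ℚ.< ε
      close m n N≤m N≤n = begin-strict
        ℚ.∣ a ℚ.- d ∣
          ≡⟨ cong ℚ.∣_∣ (solve 4 (λ a b c d → a :- d := (a :- b) :+ ((b :- c) :+ (c :- d)))
                          refl a b c d) ⟩
        ℚ.∣ (a ℚ.- b) ℚ.+ ((b ℚ.- c) ℚ.+ (c ℚ.- d)) ∣
          ≤⟨ ℚₚ.∣p+q∣≤∣p∣+∣q∣ (a ℚ.- b) _ ⟩
        ℚ.∣ a ℚ.- b ∣ ℚ.+ ℚ.∣ (b ℚ.- c) ℚ.+ (c ℚ.- d) ∣
          ≤⟨ ℚₚ.+-monoʳ-≤ ℚ.∣ a ℚ.- b ∣ (ℚₚ.∣p+q∣≤∣p∣+∣q∣ (b ℚ.- c) (c ℚ.- d)) ⟩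
        ℚ.∣ a ℚ.- b ∣ ℚ.+ (ℚ.∣ b ℚ.- c ∣ ℚ.+ ℚ.∣ c ℚ.- d ∣)
          <⟨ ℚₚ.+-mono-≤-< (tail m (ℕₚ.m⊔n≤o⇒m≤o _ _ N≤m))
              (ℚₚ.+-mono-<-≤
                (proj₂ fixed m n (ℕₚ.m⊔n≤o⇒n≤o _ _ N≤m) (ℕₚ.m⊔n≤o⇒n≤o _ _ N≤n))
                (ℚₚ.≤-trans (ℚₚ.≤-reflexive (∣∣-comm c d))
                  (tail n (ℕₚ.m⊔n≤o⇒m≤o _ _ N≤n)))) ⟩
        (δ ℚ.+ δ) ℚ.+ (½ ℚ.* ε ℚ.+ (δ ℚ.+ δ))
          ≡⟨ solve 1 (λ e → let δ' = (con ½ :* con ½) :* (con ½ :* e) in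
                      (δ' :+ δ') :+ (con ½ :* e :+ (δ' :+ δ')) := e) refl ε ⟩
        ε ∎
        where
        open ℚₚ.≤-Reasoning
        open +-*-Solver
        a = expSum (x m) m
        b = expSum (x m) L
        c = expSum (x n) L
        d = expSum (x n) n
      go : ∃ λ N → ∀ m n → N ℕ.≤ m → N ℕ.≤ n →
           ℚ.∣ expSum (x m) m ℚ.- expSum (x n) n ∣ ℚ.< ε
      go = N , close

open ExpLemmas

-- The power series converges uniformly on bounded sets of rationals, so the
-- n-th partial sum may be evaluated at the n-th approximation of x.
exp : ℝ → ℝ
exp x = mkℝ (λ n → expSum (seq x n) n) (exp-cauchy (cauchy x))

-- L is the limit of g t as t → 0⁺.
IsLimit₀₊ : ((t : ℝ) → 0ℝ < t → ℝ) → ℝ → Set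
IsLimit₀₊ g L = ∀ ε → 0ℝ < ε → ∃ λ δ → 0ℝ < δ ×
  (∀ t (0<t : 0ℝ < t) → t < δ → ∣ g t 0<t - L ∣ < ε)

module _ {A : Set} where

  ∑ ∏ : List A → (A → ℝ) → ℝ
  ∑ xs g = foldr _+_ 0ℝ (map g xs)
  ∏ xs g = foldr _*_ 1ℝ (map g xs)

allSubsets : ∀ n → List (Subset n)
allSubsets zero    = [] ∷ []
allSubsets (suc n) = map (outside ∷_) (allSubsets n) ++ map (inside ∷_) (allSubsets n)

elements : ∀ {n} → Subset n → List (Fin n)
elements {n} S = filter (_∈? S) (allFin n)

module _ {n : ℕ} where

  NonNegative : (Subset n → ℝ) → Set
  NonNegative f = ∀ S → 0ℝ ≤ f S

  Monotone : (Subset n → ℝ) → Set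
  Monotone f = ∀ S T → S ⊆ T → f S ≤ f T

  Submodular : (Subset n → ℝ) → Set
  Submodular f = ∀ S T → f (S ∪ T) + f (S ∩ T) ≤ f S + f T

  -- The law of the random set R(A): prob A S is the probability that
  -- R(A) = S, for independent inclusions with probabilities 1 - exp (- A u).
  prob : Vector ℝ n → Subset n → ℝ
  prob A S = ∏ (allFin n) λ u →
    if does (u ∈? S) then 1ℝ - exp (- A u) else exp (- A u)

  -- E[f(R(A))]
  extension : (Subset n → ℝ) → Vector ℝ n → ℝ
  extension f A = ∑ (allSubsets n) λ S → prob A S * f S

  -- A ⊕ (u,[t])
  increase : Vector ℝ n → Fin n → ℝ → Vector ℝ n
  increase A u t = updateAt A u (_+ t)

  differenceQuotient : (Subset n → ℝ) → Vector ℝ n → Fin n → (t : ℝ) → 0ℝ < t → ℝ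
  differenceQuotient f A u t 0<t =
    (extension f (increase A u t) - extension f A) * inv t 0<t

  -- L is the marginal value of u given A.
  IsMarginal : (Subset n → ℝ) → Vector ℝ n → Fin n → ℝ → Set
  IsMarginal f A u L = IsLimit₀₊ (differenceQuotient f A u) L

{-# OPTIONS --safe #-}
module Submission where

-- For a fixed set S, monotonicity and submodularity give
--   f O ≤ f S + (sum over v in O of the gain f (S ∪ v) - f S),
-- by inserting the elements of O into S one at a time and comparing each gain
-- with the gain over S itself (submodular-bound).  Averaging over S = R(A)
-- yields the theorem, provided that the expected gain of v is the marginal value
-- of v given A.
--
-- The expectation is a multilinear function 𝔼 of the probabilities of absence
-- x u = exp (- A u).  It is affine in x v with slope - D, where D is the expected
-- effect of switching v from absent to present (𝔼-affine), and the expected gain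
-- of v is x v D, since v gains something only when absent (𝔼-gain).  Increasing
-- A v by t therefore changes the extension by (exp (- A v) - exp (- (A v + t))) D,
-- and dividing by t and letting t tend to 0 gives exp (- A v) D, the expected
-- gain.
--
-- Two facts about exp are needed.  Its derivative is exp (exp-derivative); this
-- comes from comparing power series term by term, which gives a quadratic Taylor
-- error, uniform on bounded sets (taylor).  And exp (- a) lies in [0 , 1] for
-- a ≥ 0, so that averaging preserves inequalities.  This is derived from the same
-- Taylor estimate by Euler's method for y′ = - y: a step of length h maps y to
-- (1 - h) y up to an error of order h², so [0 , 1] is preserved up to a total
-- error which vanishes as the number of steps grows (EulerStep, EulerPath).

open import Defs
open CauchyLemmas
open ExpLemmas
open _≤_

open import Data.Bool.Base using (Bool; true; false; if_then_else_)
open import Data.Fin.Base using (Fin; zero; suc)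
open import Data.Fin.Properties using (suc-injective) renaming (_≟_ to _≟ᶠ_)
open import Data.Fin.Subset using (Subset; inside; outside; _⊆_; _∪_; _∩_; _∈_)
open import Data.Fin.Subset.Properties using (_∈?_; x∈p∪q⁺; x∈p∩q⁺)
open import Data.Integer.Base as ℤ using (+_)
open import Data.List.Base using (List; []; _∷_; map; foldr; allFin; tabulate; _++_)
import Data.List.Membership.Propositional as List
open import Data.List.Membership.Propositional.Properties using (∈-filter⁺; ∈-allFin)
open import Data.List.Properties using (map-tabulate)
open import Data.List.Relation.Unary.Any using (here; there)
open import Data.Nat.Base as ℕ using (ℕ; zero; suc)
import Data.Nat.Properties as ℕₚ
open import Data.Product.Base using (∃; _×_; _,_; proj₁; proj₂)
open import Data.Rational.Base as ℚ using (ℚ; 0ℚ; 1ℚ; ½)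
import Data.Rational.Properties as ℚₚ
open import Data.Rational.Solver using (module +-*-Solver)
open import Data.Sum.Base using (inj₁; inj₂)
open import Data.Vec.Base using ([]; _∷_; _[_]≔_; here; there)
open import Data.Vec.Functional using (Vector; tail)
open import Data.Vec.Functional.Properties using (updateAt-updates; updateAt-minimal)
import Data.Vec.Properties as Vecₚ
open import Function.Base using (_∘_; id)
open import Relation.Binary.PropositionalEquality
  using (_≡_; _≢_; refl; sym; trans; cong; cong₂; subst; module ≡-Reasoning)
open import Relation.Nullary.Decidable using (does; yes; no)

open +-*-Solver

-- Rational arithmetic

slack : ∀ {p q d} → 0ℚ ℚ.≤ d → p ℚ.+ d ≡ q → p ℚ.≤ q
slack 0≤d eq = ℚₚ.≤-trans (≤+nonneg 0≤d) (ℚₚ.≤-reflexive eq)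

deficit : ∀ {p q} → p ℚ.≤ q → 0ℚ ℚ.≤ q ℚ.- p
deficit {p} {q} p≤q = ℚₚ.≤-trans (ℚₚ.≤-reflexive (sym (ℚₚ.+-inverseʳ p)))
                                 (ℚₚ.+-monoˡ-≤ (ℚ.- p) p≤q)

0≤+ : ∀ {p q} → 0ℚ ℚ.≤ p → 0ℚ ℚ.≤ q → 0ℚ ℚ.≤ p ℚ.+ q
0≤+ 0≤p 0≤q = ℚₚ.≤-trans 0≤p (≤+nonneg 0≤q)

0≤* : ∀ {p q} → 0ℚ ℚ.≤ p → 0ℚ ℚ.≤ q → 0ℚ ℚ.≤ p ℚ.* q
0≤* {p} {q} 0≤p 0≤q = ℚₚ.≤-trans (ℚₚ.≤-reflexive (sym (ℚₚ.*-zeroˡ q)))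
  (ℚₚ.*-monoʳ-≤-nonNeg q {{ℚ.nonNegative 0≤q}} 0≤p)

-p≤∣p∣ : ∀ p → ℚ.- p ℚ.≤ ℚ.∣ p ∣
-p≤∣p∣ p = ℚₚ.≤-trans (p≤∣p∣ (ℚ.- p)) (ℚₚ.≤-reflexive (ℚₚ.∣-p∣≡∣p∣ p))

½+½ : ∀ ε → ½ ℚ.* ε ℚ.+ ½ ℚ.* ε ≡ ε
½+½ = solve 1 (λ e → con ½ :* e :+ con ½ :* e := e) refl

½-pos : ∀ {ε} → 0ℚ ℚ.< ε → 0ℚ ℚ.< ½ ℚ.* ε
½-pos = *-pos 0<½

⊓-pos : ∀ {p q} → 0ℚ ℚ.< p → 0ℚ ℚ.< q → 0ℚ ℚ.< p ℚ.⊓ q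
⊓-pos {p} {q} 0<p 0<q with ℚₚ.⊓-sel p q
... | inj₁ eq = subst (0ℚ ℚ.<_) (sym eq) 0<p
... | inj₂ eq = subst (0ℚ ℚ.<_) (sym eq) 0<q

quotient-cancel : ∀ p c (0<c : 0ℚ ℚ.< c) → c ℚ.* (p ℚ.* recip c 0<c) ≡ p
quotient-cancel p c 0<c = trans
  (solve 3 (λ p c r → c :* (p :* r) := (c :* r) :* p) refl p c (recip c 0<c))
  (trans (cong (ℚ._* p) (recip-inv c 0<c)) (ℚₚ.*-identityˡ p))

-- Order on the reals

infix 4 _≐_

-- The ring identities of ℝ hold for each approximation separately, as
-- identities in ℚ.  They are stated for this relation, finer than equality of
-- reals, and are then proved by ring normalisation in ℚ.
_≐_ : ℝ → ℝ → Set
x ≐ y = ∀ n → seq x n ≡ seq y n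

≐⇒≤ : ∀ {x y} → x ≐ y → x ≤ y
≐⇒≤ x≐y = mk≤ λ ε 0<ε → 0 , λ n _ →
  ℚₚ.≤-trans (ℚₚ.≤-reflexive (x≐y n)) (≤+nonneg (ℚₚ.<⇒≤ 0<ε))

≤-refl : ∀ {x} → x ≤ x
≤-refl = ≐⇒≤ (λ _ → refl)

≤-trans : ∀ {x y z} → x ≤ y → y ≤ z → x ≤ z
≤-trans {x} {y} {z} (mk≤ x≤y) (mk≤ y≤z) = mk≤ λ ε 0<ε →
  let N₁ , h₁ = x≤y (½ ℚ.* ε) (½-pos 0<ε)
      N₂ , h₂ = y≤z (½ ℚ.* ε) (½-pos 0<ε)
  in N₁ ℕ.⊔ N₂ , λ n N≤n → ℚₚ.≤-trans (h₁ n (ℕₚ.m⊔n≤o⇒m≤o N₁ N₂ N≤n))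
       (ℚₚ.≤-trans (ℚₚ.+-monoˡ-≤ (½ ℚ.* ε) (h₂ n (ℕₚ.m⊔n≤o⇒n≤o N₁ N₂ N≤n)))
         (ℚₚ.≤-reflexive (trans (ℚₚ.+-assoc (seq z n) (½ ℚ.* ε) (½ ℚ.* ε))
           (cong (seq z n ℚ.+_) (½+½ ε)))))

+-mono-≤ : ∀ {x y z w} → x ≤ y → z ≤ w → x + z ≤ y + w
+-mono-≤ {x} {y} {z} {w} (mk≤ x≤y) (mk≤ z≤w) = mk≤ λ ε 0<ε →
  let N₁ , h₁ = x≤y (½ ℚ.* ε) (½-pos 0<ε)
      N₂ , h₂ = z≤w (½ ℚ.* ε) (½-pos 0<ε)
  in N₁ ℕ.⊔ N₂ , λ n N≤n → ℚₚ.≤-trans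
       (ℚₚ.+-mono-≤ (h₁ n (ℕₚ.m⊔n≤o⇒m≤o N₁ N₂ N≤n)) (h₂ n (ℕₚ.m⊔n≤o⇒n≤o N₁ N₂ N≤n)))
       (ℚₚ.≤-reflexive (solve 3 (λ a b e → (a :+ con ½ :* e) :+ (b :+ con ½ :* e) := (a :+ b) :+ e)
         refl (seq y n) (seq w n) ε))

-- Only the difference of the two sides matters, so an inequality can be moved
-- along any ring identity between differences.
≤-rearrange : ∀ {x y z w} → (∀ n → seq y n ℚ.- seq x n ≡ seq w n ℚ.- seq z n) →
  x ≤ y → z ≤ w
≤-rearrange {x} {y} {z} {w} eq (mk≤ x≤y) = mk≤ λ ε 0<ε →
  let N , h = x≤y ε 0<ε
  in N , λ n N≤n → slack (deficit (h n N≤n))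
       (trans (shift (seq x n) (seq y n) (seq z n) ε)
       (trans (cong (λ d → (d ℚ.+ seq z n) ℚ.+ ε) (eq n)) (cancel (seq z n) (seq w n) ε)))
  where
  shift : ∀ x y z ε → z ℚ.+ ((y ℚ.+ ε) ℚ.- x) ≡ ((y ℚ.- x) ℚ.+ z) ℚ.+ ε
  shift = solve 4 (λ x y z e → z :+ ((y :+ e) :- x) := ((y :- x) :+ z) :+ e) refl
  cancel : ∀ z w ε → ((w ℚ.- z) ℚ.+ z) ℚ.+ ε ≡ w ℚ.+ ε
  cancel = solve 3 (λ z w e → ((w :- z) :+ z) :+ e := w :+ e) refl

≤⇒0≤- : ∀ {x y} → x ≤ y → 0ℝ ≤ y - x
≤⇒0≤- {x} {y} = ≤-rearrange {x} {y} {0ℝ} {y - x} λ n → sym (ℚₚ.+-identityʳ (seq y n ℚ.- seq x n))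

0≤-⇒≤ : ∀ {x y} → 0ℝ ≤ y - x → x ≤ y
0≤-⇒≤ {x} {y} = ≤-rearrange {0ℝ} {y - x} {x} {y} λ n → ℚₚ.+-identityʳ (seq y n ℚ.- seq x n)

+-nonneg : ∀ {x y} → 0ℝ ≤ x → 0ℝ ≤ y → 0ℝ ≤ x + y
+-nonneg {x} {y} 0≤x 0≤y = ≤-trans {0ℝ} {0ℝ + 0ℝ} {x + y} (≐⇒≤ (λ _ → refl))
  (+-mono-≤ {0ℝ} {x} {0ℝ} {y} 0≤x 0≤y)

EventuallyNonneg : (ℕ → ℚ) → Set
EventuallyNonneg a = ∀ ε → 0ℚ ℚ.< ε → ∃ λ N → ∀ n → N ℕ.≤ n → 0ℚ ℚ.≤ a n ℚ.+ ε

-- Once a + δ and b + δ are nonnegative, so is their product, which exceeds a b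
-- by δ (a + b + δ); a bound on the sequences makes this at most ε.
*-eventuallyNonneg : ∀ {a b A B} → 0ℚ ℚ.< A → 0ℚ ℚ.< B →
  (∀ n → ℚ.∣ a n ∣ ℚ.≤ A) → (∀ n → ℚ.∣ b n ∣ ℚ.≤ B) →
  EventuallyNonneg a → EventuallyNonneg b → EventuallyNonneg (λ n → a n ℚ.* b n)
*-eventuallyNonneg {a} {b} {A} {B} 0<A 0<B a≤A b≤B 0≤a 0≤b ε 0<ε = N₁ ℕ.⊔ N₂ , bound
  where
  K = A ℚ.+ (B ℚ.+ 1ℚ)
  0<K : 0ℚ ℚ.< K
  0<K = ℚₚ.<-≤-trans 0<A (≤+nonneg (0≤+ (ℚₚ.<⇒≤ 0<B) (ℚₚ.<⇒≤ 0<1)))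
  -- δ ≤ 1 bounds a + b + δ by K; then K δ ≤ ε.
  δ = 1ℚ ℚ.⊓ (ε ℚ.* recip K 0<K)
  0<δ : 0ℚ ℚ.< δ
  0<δ = ⊓-pos 0<1 (*-pos 0<ε (recip-pos K 0<K))
  N₁ = proj₁ (0≤a δ 0<δ)
  N₂ = proj₁ (0≤b δ 0<δ)
  Kδ≤ε : K ℚ.* δ ℚ.≤ ε
  Kδ≤ε = ℚₚ.≤-trans
    (ℚₚ.*-monoˡ-≤-nonNeg K {{ℚ.nonNegative (ℚₚ.<⇒≤ 0<K)}} (ℚₚ.p⊓q≤q 1ℚ _))
    (ℚₚ.≤-reflexive (quotient-cancel ε K 0<K))
  identity : ∀ a b d A B e →
    (((a ℚ.+ d) ℚ.* (b ℚ.+ d)) ℚ.+ d ℚ.* ((A ℚ.- a) ℚ.+ ((B ℚ.- b) ℚ.+ (1ℚ ℚ.- d))))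
    ℚ.+ (e ℚ.- (A ℚ.+ (B ℚ.+ 1ℚ)) ℚ.* d) ≡ a ℚ.* b ℚ.+ e
  identity = solve 6
    (λ a b d A B e → ((a :+ d) :* (b :+ d) :+ d :* ((A :- a) :+ ((B :- b) :+ (con 1ℚ :- d))))
                     :+ (e :- (A :+ (B :+ con 1ℚ)) :* d)
                    := a :* b :+ e)
    refl
  bound : ∀ n → N₁ ℕ.⊔ N₂ ℕ.≤ n → 0ℚ ℚ.≤ a n ℚ.* b n ℚ.+ ε
  bound n N≤n = ℚₚ.≤-trans
    (0≤+ (0≤+ (0≤* (proj₂ (0≤a δ 0<δ) n (ℕₚ.m⊔n≤o⇒m≤o N₁ N₂ N≤n))
                   (proj₂ (0≤b δ 0<δ) n (ℕₚ.m⊔n≤o⇒n≤o N₁ N₂ N≤n)))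
              (0≤* (ℚₚ.<⇒≤ 0<δ) (0≤+ (deficit (ℚₚ.≤-trans (p≤∣p∣ (a n)) (a≤A n)))
                (0≤+ (deficit (ℚₚ.≤-trans (p≤∣p∣ (b n)) (b≤B n)))
                     (deficit (ℚₚ.p⊓q≤p 1ℚ (ε ℚ.* recip K 0<K)))))))
         (deficit Kδ≤ε))
    (ℚₚ.≤-reflexive (identity (a n) (b n) δ A B ε))

*-nonneg : ∀ {x y} → 0ℝ ≤ x → 0ℝ ≤ y → 0ℝ ≤ x * y
*-nonneg {x} {y} (mk≤ 0≤x) (mk≤ 0≤y) = mk≤ (*-eventuallyNonneg
  (proj₁ (proj₂ (bounded (cauchy x)))) (proj₁ (proj₂ (bounded (cauchy y))))
  (proj₂ (proj₂ (bounded (cauchy x)))) (proj₂ (proj₂ (bounded (cauchy y)))) 0≤x 0≤y)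

*-monoˡ-≤ : ∀ {x y z} → 0ℝ ≤ z → x ≤ y → z * x ≤ z * y
*-monoˡ-≤ {x} {y} {z} 0≤z x≤y = ≤-rearrange {0ℝ} {z * (y - x)} {z * x} {z * y}
  (λ n → distrib (seq x n) (seq y n) (seq z n))
  (*-nonneg {z} {y - x} 0≤z (≤⇒0≤- {x} {y} x≤y))
  where
  distrib : ∀ x y z → z ℚ.* (y ℚ.- x) ℚ.- 0ℚ ≡ z ℚ.* y ℚ.- z ℚ.* x
  distrib = solve 3 (λ x y z → z :* (y :- x) :- con 0ℚ := z :* y :- z :* x) refl

≤-fromℚ : ∀ {p q} → p ℚ.≤ q → fromℚ p ≤ fromℚ q
≤-fromℚ p≤q = mk≤ λ ε 0<ε → 0 , λ _ _ → ℚₚ.≤-trans p≤q (≤+nonneg (ℚₚ.<⇒≤ 0<ε))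

≤-closed : ∀ {x y} → (∀ ε → 0ℚ ℚ.< ε → x ≤ y + fromℚ ε) → x ≤ y
≤-closed {x} {y} h = mk≤ λ ε 0<ε →
  let N , g = _≤_.eventually (h (½ ℚ.* ε) (½-pos 0<ε)) (½ ℚ.* ε) (½-pos 0<ε)
  in N , λ n N≤n → ℚₚ.≤-trans (g n N≤n) (ℚₚ.≤-reflexive
       (trans (ℚₚ.+-assoc (seq y n) (½ ℚ.* ε) (½ ℚ.* ε)) (cong (seq y n ℚ.+_) (½+½ ε))))

0≤y+x : ∀ {x y} → ∣ x ∣ ≤ y → 0ℝ ≤ y + x
0≤y+x {x} {y} (mk≤ x≤y) = mk≤ λ ε 0<ε →
  let N , h = x≤y ε 0<ε
  in N , λ n N≤n → ℚₚ.≤-trans (deficit (ℚₚ.≤-trans (-p≤∣p∣ (seq x n)) (h n N≤n)))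
       (ℚₚ.≤-reflexive (regroup (seq x n) (seq y n) ε))
  where
  regroup : ∀ x y ε → (y ℚ.+ ε) ℚ.- (ℚ.- x) ≡ (y ℚ.+ x) ℚ.+ ε
  regroup = solve 3 (λ x y e → (y :+ e) :- (:- x) := (y :+ x) :+ e) refl

0≤y-x : ∀ {x y} → ∣ x ∣ ≤ y → 0ℝ ≤ y - x
0≤y-x {x} {y} (mk≤ x≤y) = mk≤ λ ε 0<ε →
  let N , h = x≤y ε 0<ε
  in N , λ n N≤n → ℚₚ.≤-trans (deficit (ℚₚ.≤-trans (p≤∣p∣ (seq x n)) (h n N≤n)))
       (ℚₚ.≤-reflexive (regroup (seq x n) (seq y n) ε))
  where
  regroup : ∀ x y ε → (y ℚ.+ ε) ℚ.- x ≡ (y ℚ.- x) ℚ.+ ε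
  regroup = solve 3 (λ x y e → (y :+ e) :- x := (y :- x) :+ e) refl

-- Finite sums

∑-++ : ∀ {A : Set} (xs ys : List A) (g : A → ℝ) → ∑ (xs ++ ys) g ≐ ∑ xs g + ∑ ys g
∑-++ []       ys g = λ k → sym (ℚₚ.+-identityˡ _)
∑-++ (x ∷ xs) ys g = λ k →
  trans (cong (seq (g x) k ℚ.+_) (∑-++ xs ys g k))
        (sym (ℚₚ.+-assoc (seq (g x) k) (seq (∑ xs g) k) (seq (∑ ys g) k)))

∑-mono-≤ : ∀ {A : Set} (xs : List A) {g h : A → ℝ} → (∀ a → g a ≤ h a) → ∑ xs g ≤ ∑ xs h
∑-mono-≤ []       g≤h = ≤-refl
-- Rewrapping leaves only the approximations to be compared; those of the sum over
-- x ∷ xs unfold to the ones of g x + ∑ xs g.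
∑-mono-≤ (x ∷ xs) {g} {h} g≤h = mk≤ (eventually
  (+-mono-≤ {g x} {h x} {∑ xs g} {∑ xs h} (g≤h x) (∑-mono-≤ xs g≤h)))

-- The expectation as a multilinear function

slice : ∀ {n} → Bool → (Subset (suc n) → ℝ) → Subset n → ℝ
slice s f S = f (s ∷ S)

-- The expectation of f on a random set that misses u with probability x u,
-- independently of the other elements: condition on the first element and
-- recurse.  This form lets every property of the expectation be proved by
-- induction on the ground set.  The parameters are probabilities of absence
-- because these are the plain exponentials exp (- A u).
𝔼 : ∀ {n} → Vector ℝ n → (Subset n → ℝ) → ℝ
𝔼 {zero}  x f = f []
𝔼 {suc n} x f = x zero * 𝔼 (tail x) (slice outside f)
              + (1ℝ - x zero) * 𝔼 (tail x) (slice inside f)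

absence : ∀ {n} → Vector ℝ n → Vector ℝ n
absence A u = exp (- A u)

choice : ℝ → Bool → ℝ
choice x s = if s then 1ℝ - x else x

weight : ∀ {n} → Vector ℝ n → Subset n → Fin n → ℝ
weight A S u = if does (u ∈? S) then 1ℝ - exp (- A u) else exp (- A u)

weight-∷ : ∀ {n} (A : Vector ℝ (suc n)) s S u → weight A (s ∷ S) (suc u) ≐ weight (tail A) S u
weight-∷ A s S u = go (does (u ∈? S))
  where
  go : ∀ b k → seq (if b then 1ℝ - exp (- A (suc u)) else exp (- A (suc u))) k ≡
               seq (if b then 1ℝ - exp (- (tail A) u) else exp (- (tail A) u)) k
  go true  k = refl
  go false k = refl

prob-∷ : ∀ {n} (A : Vector ℝ (suc n)) s S →
  prob A (s ∷ S) ≐ choice (absence A zero) s * prob (tail A) S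
prob-∷ {n} A s S = λ k → cong₂ ℚ._*_ (head s k) (trans
  (cong (λ us → seq (∏ us (weight A (s ∷ S))) k) (sym (map-tabulate id suc)))
  (rest k (allFin n)))
  where
  head : ∀ s k → seq (weight A (s ∷ S) zero) k ≡
                 seq (choice (absence A zero) s) k
  head inside  k = refl
  head outside k = refl
  rest : ∀ k us → seq (∏ (map suc us) (weight A (s ∷ S))) k ≡
                  seq (∏ us (weight (tail A) S)) k
  rest k []       = refl
  rest k (u ∷ us) = cong₂ ℚ._*_ (weight-∷ A s S u k) (rest k us)

𝔼-cong : ∀ {n} {x y : Vector ℝ n} {f g : Subset n → ℝ} →
  (∀ u → x u ≐ y u) → (∀ S → f S ≐ g S) → 𝔼 x f ≐ 𝔼 y g
𝔼-cong {zero}  x≐y f≐g k = f≐g [] k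
𝔼-cong {suc n} x≐y f≐g k = cong₂ ℚ._+_
  (cong₂ ℚ._*_ (x≐y zero k) (𝔼-cong (x≐y ∘ suc) (f≐g ∘ (outside ∷_)) k))
  (cong₂ ℚ._*_ (cong (λ p → 1ℚ ℚ.- p) (x≐y zero k)) (𝔼-cong (x≐y ∘ suc) (f≐g ∘ (inside ∷_)) k))

-- Listing the subsets by membership of the first element splits the sum in two,
-- and the factor of that element comes out of each half.
extension≐𝔼 : ∀ {n} (f : Subset n → ℝ) (A : Vector ℝ n) → extension f A ≐ 𝔼 (absence A) f
extension≐𝔼 {zero}  f A = λ k →
  trans (ℚₚ.+-identityʳ _) (ℚₚ.*-identityˡ (seq (f []) k))
extension≐𝔼 {suc n} f A = λ k → trans
  (∑-++ (map (outside ∷_) (allSubsets n)) (map (inside ∷_) (allSubsets n))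
    (λ S → prob A S * f S) k)
  (cong₂ ℚ._+_
    (trans (branch outside k (allSubsets n)) (cong (seq (absence A zero) k ℚ.*_) (rest outside k)))
    (trans (branch inside k (allSubsets n)) (cong (seq (1ℝ - absence A zero) k ℚ.*_) (rest inside k))))
  where
  rest : ∀ s → extension (slice s f) (tail A) ≐ 𝔼 (tail (absence A)) (slice s f)
  rest s k = trans (extension≐𝔼 (slice s f) (tail A) k)
    (𝔼-cong {x = absence (tail A)} {tail (absence A)} {slice s f} {slice s f} (λ _ _ → refl) (λ _ _ → refl) k)
  expand : ∀ w c p f {t t′} → w ≡ c ℚ.* p → t ≡ c ℚ.* t′ →
    w ℚ.* f ℚ.+ t ≡ c ℚ.* (p ℚ.* f ℚ.+ t′)
  expand w c p f {t} {t′} refl refl = solve 4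
    (λ c p f t′ → (c :* p) :* f :+ c :* t′ := c :* (p :* f :+ t′)) refl c p f t′
  branch : ∀ s k Ss → seq (∑ (map (s ∷_) Ss) λ S → prob A S * f S) k ≡
    seq (choice (absence A zero) s) k ℚ.* seq (∑ Ss λ S → prob (tail A) S * slice s f S) k
  branch s k []       = sym (ℚₚ.*-zeroʳ (seq (choice (absence A zero) s) k))
  branch s k (S ∷ Ss) = expand (seq (prob A (s ∷ S)) k) (seq (choice (absence A zero) s) k)
    (seq (prob (tail A) S) k) (seq (slice s f S) k) (prob-∷ A s S k) (branch s k Ss)

-- The conditioning step in the recursion for 𝔼, on a single approximation.
mix : ℚ → ℚ → ℚ → ℚ
mix p a b = p ℚ.* a ℚ.+ (1ℚ ℚ.- p) ℚ.* b

mix-const : ∀ p c → mix p c c ≡ c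
mix-const = solve 2 (λ p c → p :* c :+ (con 1ℚ :- p) :* c := c) refl

mix-+ : ∀ p a b c d → mix p (a ℚ.+ b) (c ℚ.+ d) ≡ mix p a c ℚ.+ mix p b d
mix-+ = solve 5 (λ p a b c d → p :* (a :+ b) :+ (con 1ℚ :- p) :* (c :+ d)
  := (p :* a :+ (con 1ℚ :- p) :* c) :+ (p :* b :+ (con 1ℚ :- p) :* d)) refl

mix-minus : ∀ p a b c d → mix p (a ℚ.- b) (c ℚ.- d) ≡ mix p a c ℚ.- mix p b d
mix-minus = solve 5 (λ p a b c d → p :* (a :- b) :+ (con 1ℚ :- p) :* (c :- d)
  := (p :* a :+ (con 1ℚ :- p) :* c) :- (p :* b :+ (con 1ℚ :- p) :* d)) refl

mix-scale : ∀ p c a b → mix p (c ℚ.* a) (c ℚ.* b) ≡ c ℚ.* mix p a b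
mix-scale = solve 4 (λ p c a b → p :* (c :* a) :+ (con 1ℚ :- p) :* (c :* b)
  := c :* (p :* a :+ (con 1ℚ :- p) :* b)) refl

𝔼-const : ∀ {n} (x : Vector ℝ n) {f : Subset n → ℝ} c → (∀ S → f S ≐ c) → 𝔼 x f ≐ c
𝔼-const {zero}  x c f≐c k = f≐c [] k
𝔼-const {suc n} x c f≐c k = trans
  (cong₂ (mix (seq (x zero) k)) (𝔼-const (tail x) c (f≐c ∘ (outside ∷_)) k)
                                (𝔼-const (tail x) c (f≐c ∘ (inside ∷_)) k))
  (mix-const (seq (x zero) k) (seq c k))

-- The pointwise relation between the integrands is a hypothesis because in this
-- form it restricts to the two slices of h.
𝔼-+ : ∀ {n} (x : Vector ℝ n) {f g h : Subset n → ℝ} →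
  (∀ S → h S ≐ f S + g S) → 𝔼 x h ≐ 𝔼 x f + 𝔼 x g
𝔼-+ {zero}  x h≐ k = h≐ [] k
𝔼-+ {suc n} x {f} {g} {h} h≐ k = trans
  (cong₂ (mix (seq (x zero) k))
    (𝔼-+ (tail x) {slice outside f} {slice outside g} {slice outside h} (h≐ ∘ (outside ∷_)) k)
    (𝔼-+ (tail x) {slice inside f} {slice inside g} {slice inside h} (h≐ ∘ (inside ∷_)) k))
  (mix-+ (seq (x zero) k)
    (seq (𝔼 (tail x) (slice outside f)) k) (seq (𝔼 (tail x) (slice outside g)) k)
    (seq (𝔼 (tail x) (slice inside f)) k) (seq (𝔼 (tail x) (slice inside g)) k))

𝔼-minus : ∀ {n} (x : Vector ℝ n) {f g h : Subset n → ℝ} →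
  (∀ S → h S ≐ f S - g S) → 𝔼 x h ≐ 𝔼 x f - 𝔼 x g
𝔼-minus {zero}  x h≐ k = h≐ [] k
𝔼-minus {suc n} x {f} {g} {h} h≐ k = trans
  (cong₂ (mix (seq (x zero) k))
    (𝔼-minus (tail x) {slice outside f} {slice outside g} {slice outside h} (h≐ ∘ (outside ∷_)) k)
    (𝔼-minus (tail x) {slice inside f} {slice inside g} {slice inside h} (h≐ ∘ (inside ∷_)) k))
  (mix-minus (seq (x zero) k)
    (seq (𝔼 (tail x) (slice outside f)) k) (seq (𝔼 (tail x) (slice outside g)) k)
    (seq (𝔼 (tail x) (slice inside f)) k) (seq (𝔼 (tail x) (slice inside g)) k))

𝔼-∑ : ∀ {n} {A : Set} (x : Vector ℝ n) (vs : List A) (g : A → Subset n → ℝ)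
  {h : Subset n → ℝ} → (∀ S → h S ≐ ∑ vs (λ v → g v S)) → 𝔼 x h ≐ ∑ vs (λ v → 𝔼 x (g v))
𝔼-∑ x []       g h≐ k = 𝔼-const x 0ℝ h≐ k
𝔼-∑ x (v ∷ vs) g {h} h≐ k = trans (𝔼-+ x {g v} {λ S → ∑ vs (λ v → g v S)} {h} h≐ k)
  (cong (seq (𝔼 x (g v)) k ℚ.+_) (𝔼-∑ x vs g {λ S → ∑ vs (λ v → g v S)} (λ _ _ → refl) k))

𝔼-mono-≤ : ∀ {n} {x : Vector ℝ n} {f g : Subset n → ℝ} →
  (∀ u → 0ℝ ≤ x u) → (∀ u → x u ≤ 1ℝ) → (∀ S → f S ≤ g S) → 𝔼 x f ≤ 𝔼 x g
𝔼-mono-≤ {zero}  0≤x x≤1 f≤g = f≤g []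
𝔼-mono-≤ {suc n} {x} {f} {g} 0≤x x≤1 f≤g = mk≤ (eventually (+-mono-≤
  {x zero * 𝔼 (tail x) (slice outside f)} {x zero * 𝔼 (tail x) (slice outside g)}
  {(1ℝ - x zero) * 𝔼 (tail x) (slice inside f)} {(1ℝ - x zero) * 𝔼 (tail x) (slice inside g)}
  (*-monoˡ-≤ {𝔼 (tail x) (slice outside f)} {𝔼 (tail x) (slice outside g)} {x zero}
    (0≤x zero) (𝔼-mono-≤ (0≤x ∘ suc) (x≤1 ∘ suc) (f≤g ∘ (outside ∷_))))
  (*-monoˡ-≤ {𝔼 (tail x) (slice inside f)} {𝔼 (tail x) (slice inside g)} {1ℝ - x zero}
    (≤⇒0≤- {x zero} {1ℝ} (x≤1 zero)) (𝔼-mono-≤ (0≤x ∘ suc) (x≤1 ∘ suc) (f≤g ∘ (inside ∷_))))))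

-- gain vanishes on the sets that already contain v; effect f v S does not
-- depend on whether v lies in S.
gain effect : ∀ {n} → (Subset n → ℝ) → Fin n → Subset n → ℝ
gain   f v S = f (S [ v ]≔ inside) - f S
effect f v S = f (S [ v ]≔ inside) - f (S [ v ]≔ outside)

-- Inserting v changes the random set only if v was absent, which happens with
-- probability x v and independently of the effect.
𝔼-gain : ∀ {n} (x : Vector ℝ n) (f : Subset n → ℝ) v {g e : Subset n → ℝ} →
  (∀ S → g S ≐ gain f v S) → (∀ S → e S ≐ effect f v S) → 𝔼 x g ≐ x v * 𝔼 x e
𝔼-gain {suc n} x f zero {g} {e} g≐ e≐ k = trans
  (cong₂ (mix p)
    (𝔼-minus (tail x) {slice inside f} {slice outside f} {slice outside g} (g≐ ∘ (outside ∷_)) k)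
    (𝔼-minus (tail x) {slice inside f} {slice inside f} {slice inside g} (g≐ ∘ (inside ∷_)) k))
  (trans (collect p (seq (𝔼 (tail x) (slice inside f)) k) (seq (𝔼 (tail x) (slice outside f)) k))
    (sym (cong (p ℚ.*_) (cong₂ (mix p)
      (𝔼-minus (tail x) {slice inside f} {slice outside f} {slice outside e} (e≐ ∘ (outside ∷_)) k)
      (𝔼-minus (tail x) {slice inside f} {slice outside f} {slice inside e} (e≐ ∘ (inside ∷_)) k)))))
  where
  p = seq (x zero) k
  collect : ∀ p a b → mix p (a ℚ.- b) (a ℚ.- a) ≡ p ℚ.* mix p (a ℚ.- b) (a ℚ.- b)
  collect = solve 3 (λ p a b → p :* (a :- b) :+ (con 1ℚ :- p) :* (a :- a)
    := p :* (p :* (a :- b) :+ (con 1ℚ :- p) :* (a :- b))) refl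
𝔼-gain {suc n} x f (suc v) {g} {e} g≐ e≐ k = trans
  (cong₂ (mix (seq (x zero) k))
    (𝔼-gain (tail x) (slice outside f) v {slice outside g} {slice outside e}
      (g≐ ∘ (outside ∷_)) (e≐ ∘ (outside ∷_)) k)
    (𝔼-gain (tail x) (slice inside f) v {slice inside g} {slice inside e}
      (g≐ ∘ (inside ∷_)) (e≐ ∘ (inside ∷_)) k))
  (mix-scale (seq (x zero) k) (seq (x (suc v)) k)
    (seq (𝔼 (tail x) (slice outside e)) k) (seq (𝔼 (tail x) (slice inside e)) k))

-- The expectation is affine in x v, because each set either contains v or
-- misses it; the slope is minus the expected effect of v.
𝔼-affine : ∀ {n} (x y : Vector ℝ n) (f : Subset n → ℝ) v {e : Subset n → ℝ} →
  (∀ u → u ≢ v → y u ≐ x u) → (∀ S → e S ≐ effect f v S) →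
  𝔼 y f - 𝔼 x f ≐ (x v - y v) * 𝔼 x e
𝔼-affine {suc n} x y f zero {e} agree e≐ k = trans
  (cong₂ (λ a b → mix q a b ℚ.- seq (𝔼 x f) k) (tails outside) (tails inside))
  (trans (collect p q (seq (𝔼 (tail x) (slice inside f)) k) (seq (𝔼 (tail x) (slice outside f)) k))
    (sym (cong ((p ℚ.- q) ℚ.*_) (cong₂ (mix p)
      (𝔼-minus (tail x) {slice inside f} {slice outside f} {slice outside e} (e≐ ∘ (outside ∷_)) k)
      (𝔼-minus (tail x) {slice inside f} {slice outside f} {slice inside e} (e≐ ∘ (inside ∷_)) k)))))
  where
  p = seq (x zero) k
  q = seq (y zero) k
  tails : ∀ s → seq (𝔼 (tail y) (slice s f)) k ≡ seq (𝔼 (tail x) (slice s f)) k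
  tails s = 𝔼-cong {x = tail y} {tail x} {slice s f} {slice s f}
    (λ u → agree (suc u) λ ()) (λ _ _ → refl) k
  collect : ∀ p q a b → mix q b a ℚ.- mix p b a ≡ (p ℚ.- q) ℚ.* mix p (a ℚ.- b) (a ℚ.- b)
  collect = solve 4 (λ p q a b →
    (q :* b :+ (con 1ℚ :- q) :* a) :- (p :* b :+ (con 1ℚ :- p) :* a)
    := (p :- q) :* (p :* (a :- b) :+ (con 1ℚ :- p) :* (a :- b))) refl
𝔼-affine {suc n} x y f (suc v) {e} agree e≐ k = trans
  (cong (λ q → mix q (Y outside) (Y inside) ℚ.- seq (𝔼 x f) k) (agree zero (λ ()) k))
  (trans (sym (mix-minus p (Y outside) (X outside) (Y inside) (X inside)))
  (trans (cong₂ (mix p)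
    (𝔼-affine (tail x) (tail y) (slice outside f) v {slice outside e} rest (e≐ ∘ (outside ∷_)) k)
    (𝔼-affine (tail x) (tail y) (slice inside f) v {slice inside e} rest (e≐ ∘ (inside ∷_)) k))
  (mix-scale p (seq (x (suc v)) k ℚ.- seq (y (suc v)) k)
    (seq (𝔼 (tail x) (slice outside e)) k) (seq (𝔼 (tail x) (slice inside e)) k))))
  where
  p = seq (x zero) k
  X Y : Bool → ℚ
  X s = seq (𝔼 (tail x) (slice s f)) k
  Y s = seq (𝔼 (tail y) (slice s f)) k
  rest : ∀ u → u ≢ v → y (suc u) ≐ x (suc u)
  rest u u≢v = agree (suc u) (u≢v ∘ suc-injective)

-- Taylor expansion of the exponential

expTerm-nonneg : ∀ {M} → 0ℚ ℚ.≤ M → ∀ k → 0ℚ ℚ.≤ expTerm M k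
expTerm-nonneg 0≤M zero    = ℚₚ.<⇒≤ 0<1
expTerm-nonneg 0≤M (suc k) = 0≤* (expTerm-nonneg 0≤M k) (0≤* 0≤M (0≤1/ k))

expTerm-bound : ∀ {q M} → ℚ.∣ q ∣ ℚ.≤ M → ∀ k → ℚ.∣ expTerm q k ∣ ℚ.≤ expTerm M k
expTerm-bound q≤M zero    = ℚₚ.≤-refl
expTerm-bound {q} {M} q≤M (suc k) = ℚₚ.≤-trans
  (ℚₚ.≤-reflexive (trans (ℚₚ.∣p*q∣≡∣p∣*∣q∣ (expTerm q k) (q ℚ.* (+ 1 ℚ./ suc k)))
    (cong (ℚ.∣ expTerm q k ∣ ℚ.*_) (trans (ℚₚ.∣p*q∣≡∣p∣*∣q∣ q (+ 1 ℚ./ suc k))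
      (cong (ℚ.∣ q ∣ ℚ.*_) (ℚₚ.0≤p⇒∣p∣≡p (0≤1/ k)))))))
  (*-mono-≤ (ℚₚ.0≤∣p∣ (expTerm q k)) (0≤* 0≤M (0≤1/ k)) (expTerm-bound q≤M k)
    (ℚₚ.*-monoʳ-≤-nonNeg (+ 1 ℚ./ suc k) {{ℚ.nonNegative (0≤1/ k)}} q≤M))
  where
  0≤M : 0ℚ ℚ.≤ M
  0≤M = ℚₚ.≤-trans (ℚₚ.0≤∣p∣ q) q≤M

expTerm-suc : ∀ q k → expTerm q k ℚ.* q ≡ ι (suc k) ℚ.* expTerm q (suc k)
expTerm-suc q k = sym (trans
  (solve 4 (λ c t q r → c :* (t :* (q :* r)) := (c :* r) :* (t :* q)) refl
    (ι (suc k)) (expTerm q k) q (+ 1 ℚ./ suc k))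
  (trans (cong (ℚ._* (expTerm q k ℚ.* q)) (ι-inv k)) (ℚₚ.*-identityˡ _)))

-- The linear Taylor error of the term T (k + 1), whose derivative is T k.
remainder : ℚ → ℚ → ℕ → ℚ
remainder q h k = expTerm (q ℚ.+ h) (suc k) ℚ.- expTerm q (suc k) ℚ.- h ℚ.* expTerm q k

-- Multiplying the expansion of one term by (q + h) / (k + 2) produces the
-- expansion of the next, because (k + 1) T (k + 1) q = q T k q makes the parts
-- linear in h cancel.
remainder-suc : ∀ q h k → remainder q h (suc k) ≡
  (+ 1 ℚ./ suc (suc k)) ℚ.* (h ℚ.* h ℚ.* expTerm q k ℚ.+ remainder q h k ℚ.* (q ℚ.+ h))
remainder-suc q h k = begin
  t′ ℚ.* ((q ℚ.+ h) ℚ.* r) ℚ.- t₁ ℚ.* (q ℚ.* r) ℚ.- h ℚ.* t₁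
    ≡⟨ identity q h r (ι (suc k)) t t₁ t′ ⟩
  main ℚ.+ (r ℚ.* h ℚ.* (t ℚ.* q ℚ.- ι (suc k) ℚ.* t₁) ℚ.- h ℚ.* t₁ ℚ.* (1ℚ ℚ.- (1ℚ ℚ.+ ι (suc k)) ℚ.* r))
    ≡⟨ cong₂ (λ a b → main ℚ.+ (r ℚ.* h ℚ.* (a ℚ.- ι (suc k) ℚ.* t₁) ℚ.- h ℚ.* t₁ ℚ.* (1ℚ ℚ.- b)))
         (expTerm-suc q k) (trans (cong (ℚ._* r) (sym (ι-suc (suc k)))) (ι-inv (suc k))) ⟩
  main ℚ.+ (r ℚ.* h ℚ.* (ι (suc k) ℚ.* t₁ ℚ.- ι (suc k) ℚ.* t₁) ℚ.- h ℚ.* t₁ ℚ.* (1ℚ ℚ.- 1ℚ))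
    ≡⟨ vanish main (r ℚ.* h) (ι (suc k) ℚ.* t₁) (h ℚ.* t₁) ⟩
  main ∎
  where
  open ≡-Reasoning
  r = + 1 ℚ./ suc (suc k)
  t = expTerm q k
  t₁ = expTerm q (suc k)
  t′ = expTerm (q ℚ.+ h) (suc k)
  main = r ℚ.* (h ℚ.* h ℚ.* t ℚ.+ remainder q h k ℚ.* (q ℚ.+ h))
  identity : ∀ q h r c t t₁ t′ →
    t′ ℚ.* ((q ℚ.+ h) ℚ.* r) ℚ.- t₁ ℚ.* (q ℚ.* r) ℚ.- h ℚ.* t₁ ≡
    r ℚ.* (h ℚ.* h ℚ.* t ℚ.+ (t′ ℚ.- t₁ ℚ.- h ℚ.* t) ℚ.* (q ℚ.+ h))
    ℚ.+ (r ℚ.* h ℚ.* (t ℚ.* q ℚ.- c ℚ.* t₁) ℚ.- h ℚ.* t₁ ℚ.* (1ℚ ℚ.- (1ℚ ℚ.+ c) ℚ.* r))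
  identity = solve 7 (λ q h r c t t₁ t′ →
    t′ :* ((q :+ h) :* r) :- t₁ :* (q :* r) :- h :* t₁ :=
    r :* (h :* h :* t :+ (t′ :- t₁ :- h :* t) :* (q :+ h))
    :+ (r :* h :* (t :* q :- c :* t₁) :- h :* t₁ :* (con 1ℚ :- (con 1ℚ :+ c) :* r))) refl
  vanish : ∀ m a b c → m ℚ.+ (a ℚ.* (b ℚ.- b) ℚ.- c ℚ.* (1ℚ ℚ.- 1ℚ)) ≡ m
  vanish = solve 4 (λ m a b c → m :+ (a :* (b :- b) :- c :* (con 1ℚ :- con 1ℚ)) := m) refl

-- T (k - 1) M, with value 0 at k = 0, where the remainder vanishes.
shifted : ℚ → ℕ → ℚ
shifted M zero    = 0ℚ
shifted M (suc k) = expTerm M k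

shifted-suc : ∀ M k → shifted M k ℚ.* M ≡ ι k ℚ.* expTerm M k
shifted-suc M zero    = trans (ℚₚ.*-zeroˡ M) (sym (ℚₚ.*-zeroˡ 1ℚ))
shifted-suc M (suc k) = expTerm-suc M k

-- In the recursion, M T (k - 1) M = k T k M turns the bound for k into
-- (1 + k) / (k + 2) times the bound for k + 1, a factor of at most 1.
remainder-bound : ∀ {q h M} → ℚ.∣ q ∣ ℚ.≤ M → ℚ.∣ q ℚ.+ h ∣ ℚ.≤ M → ∀ k →
  ℚ.∣ remainder q h k ∣ ℚ.≤ ℚ.∣ h ∣ ℚ.* ℚ.∣ h ∣ ℚ.* shifted M k
remainder-bound {q} {h} {M} q≤M q+h≤M zero = ℚₚ.≤-reflexive (trans (cong ℚ.∣_∣ (start q h))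
  (sym (ℚₚ.*-zeroʳ (ℚ.∣ h ∣ ℚ.* ℚ.∣ h ∣))))
  where
  start : ∀ q h → remainder q h 0 ≡ 0ℚ
  start = solve 2 (λ q h → con 1ℚ :* ((q :+ h) :* con 1ℚ) :- con 1ℚ :* (q :* con 1ℚ) :- h :* con 1ℚ
    := con 0ℚ) refl
remainder-bound {q} {h} {M} q≤M q+h≤M (suc k) = begin
  ℚ.∣ remainder q h (suc k) ∣
    ≡⟨ cong ℚ.∣_∣ (remainder-suc q h k) ⟩
  ℚ.∣ r ℚ.* (h ℚ.* h ℚ.* t ℚ.+ ρ ℚ.* (q ℚ.+ h)) ∣
    ≡⟨ trans (ℚₚ.∣p*q∣≡∣p∣*∣q∣ r _) (cong (ℚ._* ℚ.∣ h ℚ.* h ℚ.* t ℚ.+ ρ ℚ.* (q ℚ.+ h) ∣) (ℚₚ.0≤p⇒∣p∣≡p 0≤r)) ⟩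
  r ℚ.* ℚ.∣ h ℚ.* h ℚ.* t ℚ.+ ρ ℚ.* (q ℚ.+ h) ∣
    ≤⟨ ℚₚ.*-monoˡ-≤-nonNeg r {{ℚ.nonNegative 0≤r}} (ℚₚ.≤-trans (ℚₚ.∣p+q∣≤∣p∣+∣q∣ (h ℚ.* h ℚ.* t) (ρ ℚ.* (q ℚ.+ h)))
         (ℚₚ.+-mono-≤ first second)) ⟩
  r ℚ.* (H ℚ.* T ℚ.+ H ℚ.* (ι k ℚ.* T))
    ≡⟨ solve 4 (λ r H T c → r :* (H :* T :+ H :* (c :* T)) := (r :* (con 1ℚ :+ c)) :* (H :* T)) refl r H T (ι k) ⟩
  (r ℚ.* (1ℚ ℚ.+ ι k)) ℚ.* (H ℚ.* T)
    ≤⟨ ℚₚ.*-monoʳ-≤-nonNeg (H ℚ.* T) {{ℚ.nonNegative (0≤* 0≤H 0≤T)}} ratio≤1 ⟩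
  1ℚ ℚ.* (H ℚ.* T)
    ≡⟨ ℚₚ.*-identityˡ (H ℚ.* T) ⟩
  H ℚ.* T ∎
  where
  open ℚₚ.≤-Reasoning
  r = + 1 ℚ./ suc (suc k)
  0≤r = 0≤1/ (suc k)
  t = expTerm q k
  T = expTerm M k
  ρ = remainder q h k
  H = ℚ.∣ h ∣ ℚ.* ℚ.∣ h ∣
  0≤M : 0ℚ ℚ.≤ M
  0≤M = ℚₚ.≤-trans (ℚₚ.0≤∣p∣ q) q≤M
  0≤H : 0ℚ ℚ.≤ H
  0≤H = 0≤* (ℚₚ.0≤∣p∣ h) (ℚₚ.0≤∣p∣ h)
  0≤T = expTerm-nonneg 0≤M k
  first : ℚ.∣ h ℚ.* h ℚ.* t ∣ ℚ.≤ H ℚ.* T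
  first = ℚₚ.≤-trans
    (ℚₚ.≤-reflexive (trans (ℚₚ.∣p*q∣≡∣p∣*∣q∣ (h ℚ.* h) t) (cong (ℚ._* ℚ.∣ t ∣) (ℚₚ.∣p*q∣≡∣p∣*∣q∣ h h))))
    (ℚₚ.*-monoˡ-≤-nonNeg H {{ℚ.nonNegative 0≤H}} (expTerm-bound q≤M k))
  second : ℚ.∣ ρ ℚ.* (q ℚ.+ h) ∣ ℚ.≤ H ℚ.* (ι k ℚ.* T)
  second = begin
    ℚ.∣ ρ ℚ.* (q ℚ.+ h) ∣         ≡⟨ ℚₚ.∣p*q∣≡∣p∣*∣q∣ ρ (q ℚ.+ h) ⟩
    ℚ.∣ ρ ∣ ℚ.* ℚ.∣ q ℚ.+ h ∣     ≤⟨ *-mono-≤ (ℚₚ.0≤∣p∣ ρ) 0≤M (remainder-bound q≤M q+h≤M k) q+h≤M ⟩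
    (H ℚ.* shifted M k) ℚ.* M     ≡⟨ ℚₚ.*-assoc H (shifted M k) M ⟩
    H ℚ.* (shifted M k ℚ.* M)     ≡⟨ cong (H ℚ.*_) (shifted-suc M k) ⟩
    H ℚ.* (ι k ℚ.* T)             ∎
  ratio≤1 : r ℚ.* (1ℚ ℚ.+ ι k) ℚ.≤ 1ℚ
  ratio≤1 = begin
    r ℚ.* (1ℚ ℚ.+ ι k)     ≡⟨ cong (r ℚ.*_) (sym (ι-suc k)) ⟩
    r ℚ.* ι (suc k)        ≤⟨ ℚₚ.*-monoˡ-≤-nonNeg r {{ℚ.nonNegative 0≤r}} (ι-mono (ℕₚ.n≤1+n (suc k))) ⟩
    r ℚ.* ι (suc (suc k))  ≡⟨ trans (ℚₚ.*-comm r (ι (suc (suc k)))) (ι-inv (suc k)) ⟩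
    1ℚ                     ∎

taylor-sum : ∀ {q h M} → ℚ.∣ q ∣ ℚ.≤ M → ℚ.∣ q ℚ.+ h ∣ ℚ.≤ M → ∀ n →
  ℚ.∣ expSum (q ℚ.+ h) (suc n) ℚ.- expSum q (suc n) ℚ.- h ℚ.* expSum q n ∣ ℚ.≤
  ℚ.∣ h ∣ ℚ.* ℚ.∣ h ∣ ℚ.* expSum M (ℕ.pred n)
taylor-sum {q} {h} {M} q≤M q+h≤M zero = ℚₚ.≤-reflexive
  (trans (cong ℚ.∣_∣ (start h)) (sym (ℚₚ.*-zeroʳ (ℚ.∣ h ∣ ℚ.* ℚ.∣ h ∣))))
  where
  start : ∀ h → (0ℚ ℚ.+ 1ℚ) ℚ.- (0ℚ ℚ.+ 1ℚ) ℚ.- h ℚ.* 0ℚ ≡ 0ℚ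
  start = solve 1 (λ h → (con 0ℚ :+ con 1ℚ) :- (con 0ℚ :+ con 1ℚ) :- h :* con 0ℚ := con 0ℚ) refl
taylor-sum {q} {h} {M} q≤M q+h≤M (suc n) = begin
  ℚ.∣ (a ℚ.+ a′) ℚ.- (b ℚ.+ b′) ℚ.- h ℚ.* (c ℚ.+ c′) ∣
    ≡⟨ cong ℚ.∣_∣ (regroup h a a′ b b′ c c′) ⟩
  ℚ.∣ (a ℚ.- b ℚ.- h ℚ.* c) ℚ.+ remainder q h n ∣
    ≤⟨ ℚₚ.∣p+q∣≤∣p∣+∣q∣ (a ℚ.- b ℚ.- h ℚ.* c) (remainder q h n) ⟩
  ℚ.∣ a ℚ.- b ℚ.- h ℚ.* c ∣ ℚ.+ ℚ.∣ remainder q h n ∣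
    ≤⟨ ℚₚ.+-mono-≤ (taylor-sum q≤M q+h≤M n) (remainder-bound q≤M q+h≤M n) ⟩
  H ℚ.* expSum M (ℕ.pred n) ℚ.+ H ℚ.* shifted M n
    ≡⟨ sym (ℚₚ.*-distribˡ-+ H (expSum M (ℕ.pred n)) (shifted M n)) ⟩
  H ℚ.* (expSum M (ℕ.pred n) ℚ.+ shifted M n)
    ≡⟨ cong (H ℚ.*_) (next n) ⟩
  H ℚ.* expSum M n ∎
  where
  open ℚₚ.≤-Reasoning
  H = ℚ.∣ h ∣ ℚ.* ℚ.∣ h ∣
  a = expSum (q ℚ.+ h) (suc n)
  a′ = expTerm (q ℚ.+ h) (suc n)
  b = expSum q (suc n)
  b′ = expTerm q (suc n)
  c = expSum q n
  c′ = expTerm q n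
  regroup : ∀ h a a′ b b′ c c′ → (a ℚ.+ a′) ℚ.- (b ℚ.+ b′) ℚ.- h ℚ.* (c ℚ.+ c′) ≡
    (a ℚ.- b ℚ.- h ℚ.* c) ℚ.+ (a′ ℚ.- b′ ℚ.- h ℚ.* c′)
  regroup = solve 7 (λ h a a′ b b′ c c′ → (a :+ a′) :- (b :+ b′) :- h :* (c :+ c′) :=
    (a :- b :- h :* c) :+ (a′ :- b′ :- h :* c′)) refl
  next : ∀ n → expSum M (ℕ.pred n) ℚ.+ shifted M n ≡ expSum M n
  next zero    = refl
  next (suc n) = refl

-- The derivative of a partial sum has one term less.  Putting the same partial
-- sum in its place costs h T n q, where the absolute value of h is at most 2 M.
taylor-approx : ∀ {q h M C} → 0ℚ ℚ.≤ M → (∀ n → ℚ.∣ expSum M n ∣ ℚ.≤ C) →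
  ℚ.∣ q ∣ ℚ.≤ M → ℚ.∣ q ℚ.+ h ∣ ℚ.≤ M → ∀ n →
  ℚ.∣ expSum (q ℚ.+ h) (suc n) ℚ.- expSum q (suc n) ℚ.- h ℚ.* expSum q (suc n) ∣ ℚ.≤
  C ℚ.* (ℚ.∣ h ∣ ℚ.* ℚ.∣ h ∣) ℚ.+ (M ℚ.+ M) ℚ.* expTerm M n
taylor-approx {q} {h} {M} {C} 0≤M sum≤C q≤M q+h≤M n = begin
  ℚ.∣ a ℚ.- b ℚ.- h ℚ.* (c ℚ.+ t) ∣
    ≡⟨ cong ℚ.∣_∣ (regroup a b h c t) ⟩
  ℚ.∣ (a ℚ.- b ℚ.- h ℚ.* c) ℚ.- h ℚ.* t ∣
    ≤⟨ ℚₚ.∣p-q∣≤∣p∣+∣q∣ (a ℚ.- b ℚ.- h ℚ.* c) (h ℚ.* t) ⟩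
  ℚ.∣ a ℚ.- b ℚ.- h ℚ.* c ∣ ℚ.+ ℚ.∣ h ℚ.* t ∣
    ≤⟨ ℚₚ.+-mono-≤ (taylor-sum q≤M q+h≤M n) (ℚₚ.≤-reflexive (ℚₚ.∣p*q∣≡∣p∣*∣q∣ h t)) ⟩
  H ℚ.* expSum M (ℕ.pred n) ℚ.+ ℚ.∣ h ∣ ℚ.* ℚ.∣ t ∣
    ≤⟨ ℚₚ.+-mono-≤
         (ℚₚ.≤-trans (ℚₚ.*-monoˡ-≤-nonNeg H {{ℚ.nonNegative (0≤* (ℚₚ.0≤∣p∣ h) (ℚₚ.0≤∣p∣ h))}}
                       (ℚₚ.≤-trans (p≤∣p∣ _) (sum≤C (ℕ.pred n))))
                     (ℚₚ.≤-reflexive (ℚₚ.*-comm H C)))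
         (*-mono-≤ (ℚₚ.0≤∣p∣ h) (expTerm-nonneg 0≤M n) h≤2M (expTerm-bound q≤M n)) ⟩
  C ℚ.* H ℚ.+ (M ℚ.+ M) ℚ.* expTerm M n ∎
  where
  open ℚₚ.≤-Reasoning
  H = ℚ.∣ h ∣ ℚ.* ℚ.∣ h ∣
  a = expSum (q ℚ.+ h) (suc n)
  b = expSum q (suc n)
  c = expSum q n
  t = expTerm q n
  regroup : ∀ a b h c t → a ℚ.- b ℚ.- h ℚ.* (c ℚ.+ t) ≡ (a ℚ.- b ℚ.- h ℚ.* c) ℚ.- h ℚ.* t
  regroup = solve 5 (λ a b h c t → a :- b :- h :* (c :+ t) := (a :- b :- h :* c) :- h :* t) refl
  h≤2M : ℚ.∣ h ∣ ℚ.≤ M ℚ.+ M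
  h≤2M = ℚₚ.≤-trans (ℚₚ.≤-reflexive (cong ℚ.∣_∣ (solve 2 (λ q h → h := (q :+ h) :- q) refl q h)))
    (ℚₚ.≤-trans (ℚₚ.∣p-q∣≤∣p∣+∣q∣ (q ℚ.+ h) q) (ℚₚ.+-mono-≤ q+h≤M q≤M))

expTerm→0 : ∀ M ε → 0ℚ ℚ.≤ M → 0ℚ ℚ.< ε → ∃ λ N → ∀ n → N ℕ.≤ n → expTerm M n ℚ.≤ ε
expTerm→0 M ε 0≤M 0<ε = N , λ n N≤n → ℚₚ.<⇒≤ (ℚₚ.≤-<-trans (ℚₚ.≤-trans (p≤∣p∣ _)
    (ℚₚ.≤-reflexive (cong ℚ.∣_∣ (last (expSum M n) (expTerm M n)))))
  (proj₂ settled (suc n) n (ℕₚ.m≤n⇒m≤1+n N≤n) N≤n))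
  where
  settled : ∃ λ N → ∀ m n → N ℕ.≤ m → N ℕ.≤ n → ℚ.∣ expSum M m ℚ.- expSum M n ∣ ℚ.< ε
  settled = modulus (exp-cauchy (const-cauchy M)) ε 0<ε
  N = proj₁ settled
  last : ∀ s t → t ≡ (s ℚ.+ t) ℚ.- s
  last = solve 2 (λ s t → t := (s :+ t) :- s) refl

-- exp is its own derivative on [- M , M], with a quadratic error.
IsTaylorConstant : ℚ → ℚ → Set
IsTaylorConstant M C = ∀ x h → ∣ x ∣ ≤ fromℚ M → ∣ x + h ∣ ≤ fromℚ M →
  ∣ exp (x + h) - exp x - h * exp x ∣ ≤ fromℚ C * (∣ h ∣ * ∣ h ∣)

-- A real bounded by M is only eventually approximated within M + 1, so the
-- rational estimates are used with M + 1.
taylor : ∀ M → 0ℚ ℚ.≤ M → ∃ λ C → 0ℚ ℚ.< C × IsTaylorConstant M C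
taylor M 0≤M = proj₁ sums , proj₁ (proj₂ sums) , λ x h x≤M x+h≤M → mk≤ λ ε 0<ε →
  let N₁ , h₁ = eventually x≤M 1ℚ 0<1
      N₂ , h₂ = eventually x+h≤M 1ℚ 0<1
      N₃ , h₃ = expTerm→0 M′ (ε ℚ.* recip (M′ ℚ.+ M′) 0<2M′) 0≤M′ (*-pos 0<ε (recip-pos _ 0<2M′))
  in suc (N₁ ℕ.⊔ N₂ ℕ.⊔ N₃) , λ
    { (suc n) (ℕ.s≤s N≤n) →
      let N₁₂≤n = ℕₚ.m⊔n≤o⇒m≤o (N₁ ℕ.⊔ N₂) N₃ N≤n
      in ℚₚ.≤-trans
        (taylor-approx {seq x (suc n)} {seq h (suc n)} 0≤M′ (proj₂ (proj₂ sums))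
          (h₁ (suc n) (ℕₚ.m≤n⇒m≤1+n (ℕₚ.m⊔n≤o⇒m≤o N₁ N₂ N₁₂≤n)))
          (h₂ (suc n) (ℕₚ.m≤n⇒m≤1+n (ℕₚ.m⊔n≤o⇒n≤o N₁ N₂ N₁₂≤n))) n)
        (ℚₚ.+-monoʳ-≤ (proj₁ sums ℚ.* (ℚ.∣ seq h (suc n) ∣ ℚ.* ℚ.∣ seq h (suc n) ∣)) (ℚₚ.≤-trans
          (ℚₚ.*-monoˡ-≤-nonNeg (M′ ℚ.+ M′) {{ℚ.nonNegative (ℚₚ.<⇒≤ 0<2M′)}}
            (h₃ n (ℕₚ.m⊔n≤o⇒n≤o (N₁ ℕ.⊔ N₂) N₃ N≤n)))
          (ℚₚ.≤-reflexive (quotient-cancel ε (M′ ℚ.+ M′) 0<2M′)))) }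
  where
  M′ = M ℚ.+ 1ℚ
  0<M′ : 0ℚ ℚ.< M′
  0<M′ = ℚₚ.<-≤-trans 0<1 (nonneg+≤ 0≤M)
  0≤M′ = ℚₚ.<⇒≤ 0<M′
  0<2M′ : 0ℚ ℚ.< M′ ℚ.+ M′
  0<2M′ = ℚₚ.<-≤-trans 0<M′ (≤+nonneg 0≤M′)
  sums : ∃ λ C → 0ℚ ℚ.< C × (∀ n → ℚ.∣ expSum M′ n ∣ ℚ.≤ C)
  sums = bounded (exp-cauchy (const-cauchy M′))

-- The exponential of a nonpositive real lies in the unit interval

-- One step of Euler's method for the equation y′ = - y.  Up to the error κ the
-- new value e′ is (1 - h) e, a convex combination of e and 0, so a value known
-- to lie in [- J , 1 + J] stays there, enlarged by κ.
module EulerStep (e e′ h : ℝ) (κ J : ℚ) (0≤h : 0ℝ ≤ h) (h≤1 : h ≤ 1ℝ)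
  (close : ∣ e′ - e - (- h) * e ∣ ≤ fromℚ κ) (0≤J : 0ℚ ℚ.≤ J) where

  0≤1-h : 0ℝ ≤ 1ℝ - h
  0≤1-h = ≤⇒0≤- {h} {1ℝ} h≤1

  lower : 0ℝ ≤ e + fromℚ J → 0ℝ ≤ e′ + fromℚ (κ ℚ.+ J)
  lower 0≤e+J = ≤-rearrange
    {0ℝ} {(fromℚ κ + (e′ - e - (- h) * e)) + ((1ℝ - h) * (e + fromℚ J) + h * fromℚ J)}
    {0ℝ} {e′ + fromℚ (κ ℚ.+ J)}
    (λ n → identity (seq e n) (seq e′ n) (seq h n) κ J)
    (+-nonneg {fromℚ κ + (e′ - e - (- h) * e)} {(1ℝ - h) * (e + fromℚ J) + h * fromℚ J}
      (0≤y+x {e′ - e - (- h) * e} {fromℚ κ} close)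
      (+-nonneg {(1ℝ - h) * (e + fromℚ J)} {h * fromℚ J}
        (*-nonneg {1ℝ - h} {e + fromℚ J} 0≤1-h 0≤e+J)
        (*-nonneg {h} {fromℚ J} 0≤h (≤-fromℚ 0≤J))))
    where
    identity : ∀ e e′ h κ J →
      ((κ ℚ.+ ((e′ ℚ.- e) ℚ.- (ℚ.- h) ℚ.* e)) ℚ.+ ((1ℚ ℚ.- h) ℚ.* (e ℚ.+ J) ℚ.+ h ℚ.* J)) ℚ.- 0ℚ ≡
      (e′ ℚ.+ (κ ℚ.+ J)) ℚ.- 0ℚ
    identity = solve 5 (λ e e′ h κ J →
      ((κ :+ ((e′ :- e) :- (:- h) :* e)) :+ ((con 1ℚ :- h) :* (e :+ J) :+ h :* J)) :- con 0ℚ :=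
      (e′ :+ (κ :+ J)) :- con 0ℚ) refl

  upper : 0ℝ ≤ fromℚ (1ℚ ℚ.+ J) - e → 0ℝ ≤ fromℚ (1ℚ ℚ.+ (κ ℚ.+ J)) - e′
  upper 0≤1+J-e = ≤-rearrange
    {0ℝ} {(fromℚ κ - (e′ - e - (- h) * e))
          + ((1ℝ - h) * (fromℚ (1ℚ ℚ.+ J) - e) + h * fromℚ (1ℚ ℚ.+ J))}
    {0ℝ} {fromℚ (1ℚ ℚ.+ (κ ℚ.+ J)) - e′}
    (λ n → identity (seq e n) (seq e′ n) (seq h n) κ J)
    (+-nonneg {fromℚ κ - (e′ - e - (- h) * e)}
              {(1ℝ - h) * (fromℚ (1ℚ ℚ.+ J) - e) + h * fromℚ (1ℚ ℚ.+ J)}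
      (0≤y-x {e′ - e - (- h) * e} {fromℚ κ} close)
      (+-nonneg {(1ℝ - h) * (fromℚ (1ℚ ℚ.+ J) - e)} {h * fromℚ (1ℚ ℚ.+ J)}
        (*-nonneg {1ℝ - h} {fromℚ (1ℚ ℚ.+ J) - e} 0≤1-h 0≤1+J-e)
        (*-nonneg {h} {fromℚ (1ℚ ℚ.+ J)} 0≤h (≤-fromℚ (0≤+ (ℚₚ.<⇒≤ 0<1) 0≤J)))))
    where
    identity : ∀ e e′ h κ J →
      ((κ ℚ.- ((e′ ℚ.- e) ℚ.- (ℚ.- h) ℚ.* e))
        ℚ.+ ((1ℚ ℚ.- h) ℚ.* ((1ℚ ℚ.+ J) ℚ.- e) ℚ.+ h ℚ.* (1ℚ ℚ.+ J))) ℚ.- 0ℚ ≡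
      ((1ℚ ℚ.+ (κ ℚ.+ J)) ℚ.- e′) ℚ.- 0ℚ
    identity = solve 5 (λ e e′ h κ J →
      ((κ :- ((e′ :- e) :- (:- h) :* e))
        :+ ((con 1ℚ :- h) :* ((con 1ℚ :+ J) :- e) :+ h :* (con 1ℚ :+ J))) :- con 0ℚ :=
      ((con 1ℚ :+ (κ :+ J)) :- e′) :- con 0ℚ) refl

-- Euler's method from 0 to - a in suc N steps of length h ≤ 1, each with an
-- error of at most κ.
module EulerPath (a : ℝ) (0≤a : 0ℝ ≤ a) (M C : ℚ) (0<M : 0ℚ ℚ.< M) (0<C : 0ℚ ℚ.< C)
  (a≤M : ∀ n → ℚ.∣ seq a n ∣ ℚ.≤ M) (expand : IsTaylorConstant M C)
  (N : ℕ) (short : (+ 1 ℚ./ suc N) ℚ.* M ℚ.≤ 1ℚ) where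

  r : ℚ
  r = + 1 ℚ./ suc N

  0≤r : 0ℚ ℚ.≤ r
  0≤r = 0≤1/ N

  κ : ℚ
  κ = C ℚ.* ((r ℚ.* M) ℚ.* (r ℚ.* M))

  0≤κ : 0ℚ ℚ.≤ κ
  0≤κ = 0≤* (ℚₚ.<⇒≤ 0<C) (0≤* (0≤* 0≤r (ℚₚ.<⇒≤ 0<M)) (0≤* 0≤r (ℚₚ.<⇒≤ 0<M)))

  h : ℝ
  h = fromℚ r * a

  point : ℕ → ℝ
  point j = - (fromℚ (ι j ℚ.* r) * a)

  ∣scaled∣ : ∀ c n → 0ℚ ℚ.≤ c → ℚ.∣ ℚ.- (c ℚ.* seq a n) ∣ ℚ.≤ c ℚ.* M
  ∣scaled∣ c n 0≤c = ℚₚ.≤-trans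
    (ℚₚ.≤-reflexive (trans (ℚₚ.∣-p∣≡∣p∣ (c ℚ.* seq a n))
      (trans (ℚₚ.∣p*q∣≡∣p∣*∣q∣ c (seq a n)) (cong (ℚ._* ℚ.∣ seq a n ∣) (ℚₚ.0≤p⇒∣p∣≡p 0≤c)))))
    (ℚₚ.*-monoˡ-≤-nonNeg c {{ℚ.nonNegative 0≤c}} (a≤M n))

  0≤ι : ∀ j → 0ℚ ℚ.≤ ι j
  0≤ι j = ι-mono ℕ.z≤n

  point≤M : ∀ j → j ℕ.≤ suc N → ∣ point j ∣ ≤ fromℚ M
  point≤M j j≤1+N = mk≤ λ ε 0<ε → 0 , λ n _ → ℚₚ.≤-trans
    (ℚₚ.≤-trans (∣scaled∣ (ι j ℚ.* r) n (0≤* (0≤ι j) 0≤r))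
      (ℚₚ.≤-trans (ℚₚ.*-monoʳ-≤-nonNeg M {{ℚ.nonNegative (ℚₚ.<⇒≤ 0<M)}}
        (ℚₚ.≤-trans (ℚₚ.*-monoʳ-≤-nonNeg r {{ℚ.nonNegative 0≤r}} (ι-mono j≤1+N))
          (ℚₚ.≤-reflexive (ι-inv N))))
        (ℚₚ.≤-reflexive (ℚₚ.*-identityˡ M))))
    (≤+nonneg (ℚₚ.<⇒≤ 0<ε))

  point-suc : ∀ j → point (suc j) ≐ point j + - h
  point-suc j n = trans (cong (λ c → ℚ.- (c ℚ.* r ℚ.* seq a n)) (ι-suc j))
    (distrib (ι j) r (seq a n))
    where
    distrib : ∀ c r a → ℚ.- ((1ℚ ℚ.+ c) ℚ.* r ℚ.* a) ≡ ℚ.- (c ℚ.* r ℚ.* a) ℚ.+ ℚ.- (r ℚ.* a)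
    distrib = solve 3 (λ c r a → :- ((con 1ℚ :+ c) :* r :* a) := :- (c :* r :* a) :+ :- (r :* a)) refl

  exp-point-suc : ∀ j → exp (point (suc j)) ≐ exp (point j + - h)
  exp-point-suc j n = cong (λ q → expSum q n) (point-suc j n)

  next≤M : ∀ j → j ℕ.≤ N → ∣ point j + - h ∣ ≤ fromℚ M
  next≤M j j≤N = ≤-trans {∣ point j + - h ∣} {∣ point (suc j) ∣} {fromℚ M}
    (≐⇒≤ {∣ point j + - h ∣} {∣ point (suc j) ∣} λ n → cong ℚ.∣_∣ (sym (point-suc j n)))
    (point≤M (suc j) (ℕ.s≤s j≤N))

  close : ∀ j → j ℕ.≤ N →
    ∣ exp (point j + - h) - exp (point j) - (- h) * exp (point j) ∣ ≤ fromℚ κ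
  close j j≤N = ≤-trans {_} {fromℚ C * (∣ - h ∣ * ∣ - h ∣)} {fromℚ κ}
    (expand (point j) (- h) (point≤M j (ℕₚ.m≤n⇒m≤1+n j≤N)) (next≤M j j≤N))
    (mk≤ λ ε 0<ε → 0 , λ n _ → ℚₚ.≤-trans
      (ℚₚ.*-monoˡ-≤-nonNeg C {{ℚ.nonNegative (ℚₚ.<⇒≤ 0<C)}}
        (*-mono-≤ (ℚₚ.0≤∣p∣ _) (0≤* 0≤r (ℚₚ.<⇒≤ 0<M)) (∣scaled∣ r n 0≤r) (∣scaled∣ r n 0≤r)))
      (≤+nonneg (ℚₚ.<⇒≤ 0<ε)))

  0≤h : 0ℝ ≤ h
  0≤h = *-nonneg {fromℚ r} {a} (≤-fromℚ 0≤r) 0≤a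

  h≤1 : h ≤ 1ℝ
  h≤1 = mk≤ λ ε 0<ε → 0 , λ n _ → ℚₚ.≤-trans
    (ℚₚ.≤-trans (ℚₚ.*-monoˡ-≤-nonNeg r {{ℚ.nonNegative 0≤r}}
      (ℚₚ.≤-trans (p≤∣p∣ (seq a n)) (a≤M n))) short)
    (≤+nonneg (ℚₚ.<⇒≤ 0<ε))

  -- The error accumulated in j steps.
  J : ℕ → ℚ
  J j = ι j ℚ.* κ

  J-suc : ∀ j → κ ℚ.+ J j ≡ J (suc j)
  J-suc j = trans (solve 2 (λ k c → k :+ c :* k := (con 1ℚ :+ c) :* k) refl κ (ι j))
                  (cong (ℚ._* κ) (sym (ι-suc j)))

  0≤J : ∀ j → 0ℚ ℚ.≤ J j
  0≤J j = 0≤* (0≤ι j) 0≤κ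

  -- Not at index 0, where the partial sum is empty.
  exp-start : ∀ n → seq (exp (point 0)) (suc n) ≡ 1ℚ
  exp-start n = trans (cong (λ q → expSum q (suc n)) (zero-point r (seq a (suc n)))) (expSum-0 n)
    where
    zero-point : ∀ r a → ℚ.- (0ℚ ℚ.* r ℚ.* a) ≡ 0ℚ
    zero-point = solve 2 (λ r a → :- (con 0ℚ :* r :* a) := con 0ℚ) refl
    expTerm-0 : ∀ n → expTerm 0ℚ (suc n) ≡ 0ℚ
    expTerm-0 n = trans (cong (expTerm 0ℚ n ℚ.*_) (ℚₚ.*-zeroˡ (+ 1 ℚ./ suc n))) (ℚₚ.*-zeroʳ (expTerm 0ℚ n))
    expSum-0 : ∀ n → expSum 0ℚ (suc n) ≡ 1ℚ
    expSum-0 zero    = refl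
    expSum-0 (suc n) = trans (cong₂ ℚ._+_ (expSum-0 n) (expTerm-0 n)) (ℚₚ.+-identityʳ 1ℚ)

  lower : ∀ j → j ℕ.≤ suc N → 0ℝ ≤ exp (point j) + fromℚ (J j)
  lower zero    _ = mk≤ λ ε 0<ε → 1 , λ { (suc n) _ → ℚₚ.≤-trans
    (0≤+ (0≤+ (ℚₚ.<⇒≤ 0<1) (0≤J 0)) (ℚₚ.<⇒≤ 0<ε))
    (ℚₚ.≤-reflexive (cong (λ p → (p ℚ.+ J 0) ℚ.+ ε) (sym (exp-start n)))) }
  lower (suc j) (ℕ.s≤s j≤N) = ≤-trans
    {0ℝ} {exp (point j + - h) + fromℚ (κ ℚ.+ J j)} {exp (point (suc j)) + fromℚ (J (suc j))}
    (EulerStep.lower (exp (point j)) (exp (point j + - h)) h κ (J j) 0≤h h≤1 (close j j≤N) (0≤J j)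
      (lower j (ℕₚ.m≤n⇒m≤1+n j≤N)))
    (≐⇒≤ {exp (point j + - h) + fromℚ (κ ℚ.+ J j)} {exp (point (suc j)) + fromℚ (J (suc j))}
      λ n → cong₂ ℚ._+_ (sym (exp-point-suc j n)) (J-suc j))

  upper : ∀ j → j ℕ.≤ suc N → 0ℝ ≤ fromℚ (1ℚ ℚ.+ J j) - exp (point j)
  upper zero    _ = mk≤ λ ε 0<ε → 1 , λ { (suc n) _ → ℚₚ.≤-trans
    (0≤+ (0≤J 0) (ℚₚ.<⇒≤ 0<ε))
    (ℚₚ.≤-reflexive (trans (cong (ℚ._+ ε) (cancel (J 0)))
      (cong (λ p → ((1ℚ ℚ.+ J 0) ℚ.- p) ℚ.+ ε) (sym (exp-start n))))) }
    where
    cancel : ∀ J → J ≡ (1ℚ ℚ.+ J) ℚ.- 1ℚ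
    cancel = solve 1 (λ J → J := (con 1ℚ :+ J) :- con 1ℚ) refl
  upper (suc j) (ℕ.s≤s j≤N) = ≤-trans
    {0ℝ} {fromℚ (1ℚ ℚ.+ (κ ℚ.+ J j)) - exp (point j + - h)} {fromℚ (1ℚ ℚ.+ J (suc j)) - exp (point (suc j))}
    (EulerStep.upper (exp (point j)) (exp (point j + - h)) h κ (J j) 0≤h h≤1 (close j j≤N) (0≤J j)
      (upper j (ℕₚ.m≤n⇒m≤1+n j≤N)))
    (≐⇒≤ {fromℚ (1ℚ ℚ.+ (κ ℚ.+ J j)) - exp (point j + - h)} {fromℚ (1ℚ ℚ.+ J (suc j)) - exp (point (suc j))}
      λ n → cong₂ (λ p q → (1ℚ ℚ.+ p) ℚ.- q) (J-suc j) (sym (exp-point-suc j n)))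

  exp-end : exp (point (suc N)) ≐ exp (- a)
  exp-end n = cong (λ q → expSum q n) (trans (cong (λ c → ℚ.- (c ℚ.* seq a n)) (ι-inv N))
    (cong (ℚ.-_) (ℚₚ.*-identityˡ (seq a n))))

  J-end : J (suc N) ≡ r ℚ.* (C ℚ.* (M ℚ.* M))
  J-end = trans (solve 4 (λ c r C M → c :* (C :* ((r :* M) :* (r :* M))) := (c :* r) :* (r :* (C :* (M :* M))))
                  refl (ι (suc N)) r C M)
         (trans (cong (ℚ._* (r ℚ.* (C ℚ.* (M ℚ.* M)))) (ι-inv N)) (ℚₚ.*-identityˡ _))

  module _ (ε : ℚ) (small : r ℚ.* (C ℚ.* (M ℚ.* M)) ℚ.≤ ε) where

    J≤ε : J (suc N) ℚ.≤ ε
    J≤ε = ℚₚ.≤-trans (ℚₚ.≤-reflexive J-end) small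

    exp≥-ε : 0ℝ ≤ exp (- a) + fromℚ ε
    exp≥-ε = ≤-trans {0ℝ} {exp (point (suc N)) + fromℚ (J (suc N))} {exp (- a) + fromℚ ε}
      (lower (suc N) ℕₚ.≤-refl)
      (+-mono-≤ {exp (point (suc N))} {exp (- a)} {fromℚ (J (suc N))} {fromℚ ε}
        (≐⇒≤ {exp (point (suc N))} {exp (- a)} exp-end) (≤-fromℚ J≤ε))

    exp≤1+ε : exp (- a) ≤ 1ℝ + fromℚ ε
    exp≤1+ε = ≤-trans {exp (- a)} {exp (point (suc N))} {1ℝ + fromℚ ε}
      (≐⇒≤ {exp (- a)} {exp (point (suc N))} λ n → sym (exp-end n))
      (≤-trans {exp (point (suc N))} {fromℚ (1ℚ ℚ.+ J (suc N))} {1ℝ + fromℚ ε}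
        (0≤-⇒≤ {exp (point (suc N))} {fromℚ (1ℚ ℚ.+ J (suc N))} (upper (suc N) ℕₚ.≤-refl))
        (mk≤ (eventually (≤-fromℚ {1ℚ ℚ.+ J (suc N)} {1ℚ ℚ.+ ε} (ℚₚ.+-monoʳ-≤ 1ℚ J≤ε)))))

1/suc-small : ∀ {Z} → 0ℚ ℚ.≤ Z → (+ 1 ℚ./ suc ℤ.∣ ℚ.↥ Z ∣) ℚ.* Z ℚ.≤ 1ℚ
1/suc-small {Z} 0≤Z = ℚₚ.≤-trans
  (ℚₚ.*-monoˡ-≤-nonNeg r {{ℚ.nonNegative (0≤1/ N)}}
    (ℚₚ.≤-trans (archimedean Z) (ι-mono (ℕₚ.n≤1+n N))))
  (ℚₚ.≤-reflexive (trans (ℚₚ.*-comm r (ι (suc N))) (ι-inv N)))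
  where
  N = ℤ.∣ ℚ.↥ Z ∣
  r = + 1 ℚ./ suc N

-- After N + 1 steps the accumulated error is C M² / (N + 1).
steps : ∀ (M C ε : ℚ) → 0ℚ ℚ.< M → 0ℚ ℚ.< C → 0ℚ ℚ.< ε → ∃ λ N →
  (+ 1 ℚ./ suc N) ℚ.* M ℚ.≤ 1ℚ × (+ 1 ℚ./ suc N) ℚ.* (C ℚ.* (M ℚ.* M)) ℚ.≤ ε
steps M C ε 0<M 0<C 0<ε = N , first , second
  where
  Q = C ℚ.* (M ℚ.* M)
  0≤Q : 0ℚ ℚ.≤ Q
  0≤Q = ℚₚ.<⇒≤ (*-pos 0<C (*-pos 0<M 0<M))
  0≤1/ε = ℚₚ.<⇒≤ (recip-pos ε 0<ε)
  Z = M ℚ.+ Q ℚ.* recip ε 0<ε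
  N = ℤ.∣ ℚ.↥ Z ∣
  r = + 1 ℚ./ suc N
  rZ≤1 : r ℚ.* Z ℚ.≤ 1ℚ
  rZ≤1 = 1/suc-small (0≤+ (ℚₚ.<⇒≤ 0<M) (0≤* 0≤Q 0≤1/ε))
  r*-mono : ∀ {p} → p ℚ.≤ Z → r ℚ.* p ℚ.≤ 1ℚ
  r*-mono p≤Z = ℚₚ.≤-trans (ℚₚ.*-monoˡ-≤-nonNeg r {{ℚ.nonNegative (0≤1/ N)}} p≤Z) rZ≤1
  first : r ℚ.* M ℚ.≤ 1ℚ
  first = r*-mono (≤+nonneg (0≤* 0≤Q 0≤1/ε))
  second : r ℚ.* Q ℚ.≤ ε
  second = ℚₚ.≤-trans (ℚₚ.≤-reflexive (sym (trans (regroup ε r Q (recip ε 0<ε)) (quotient-cancel (r ℚ.* Q) ε 0<ε))))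
    (ℚₚ.≤-trans (ℚₚ.*-monoˡ-≤-nonNeg ε {{ℚ.nonNegative (ℚₚ.<⇒≤ 0<ε)}} (r*-mono (nonneg+≤ (ℚₚ.<⇒≤ 0<M))))
      (ℚₚ.≤-reflexive (ℚₚ.*-identityʳ ε)))
    where
    regroup : ∀ e r Q i → e ℚ.* (r ℚ.* (Q ℚ.* i)) ≡ e ℚ.* ((r ℚ.* Q) ℚ.* i)
    regroup = solve 4 (λ e r Q i → e :* (r :* (Q :* i)) := e :* ((r :* Q) :* i)) refl

module _ (a : ℝ) (0≤a : 0ℝ ≤ a) where

  euler : ∀ M C → 0ℚ ℚ.< M → 0ℚ ℚ.< C → (∀ n → ℚ.∣ seq a n ∣ ℚ.≤ M) → IsTaylorConstant M C →
    ∀ ε → 0ℚ ℚ.< ε → 0ℝ ≤ exp (- a) + fromℚ ε × exp (- a) ≤ 1ℝ + fromℚ ε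
  euler M C 0<M 0<C a≤M expand ε 0<ε =
    let N , short , small = steps M C ε 0<M 0<C 0<ε
    in EulerPath.exp≥-ε a 0≤a M C 0<M 0<C a≤M expand N short ε small
     , EulerPath.exp≤1+ε a 0≤a M C 0<M 0<C a≤M expand N short ε small

  exp-neg-near-unit-interval : ∀ ε → 0ℚ ℚ.< ε →
    0ℝ ≤ exp (- a) + fromℚ ε × exp (- a) ≤ 1ℝ + fromℚ ε
  exp-neg-near-unit-interval =
    let M , 0<M , a≤M = bounded (cauchy a)
        C , 0<C , expand = taylor M (ℚₚ.<⇒≤ 0<M)
    in euler M C 0<M 0<C a≤M expand

  exp-neg-nonneg : 0ℝ ≤ exp (- a)
  exp-neg-nonneg = ≤-closed {0ℝ} {exp (- a)} λ ε 0<ε → proj₁ (exp-neg-near-unit-interval ε 0<ε)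

  exp-neg≤1 : exp (- a) ≤ 1ℝ
  exp-neg≤1 = ≤-closed {exp (- a)} {1ℝ} λ ε 0<ε → proj₂ (exp-neg-near-unit-interval ε 0<ε)

-- Limits of difference quotients

-- For e ≈ exp (- a), e′ ≈ exp (- (a + t)) and r = 1 / t, the difference quotient
-- of - exp (- a) misses exp (- a) by the Taylor error divided by t.  The error of
-- approximation is taken as η c with c ≤ t, to survive that division.
quotient-error : ∀ {e e′ D t r c C B η g} → 0ℚ ℚ.≤ t → 0ℚ ℚ.≤ r → t ℚ.* r ≡ 1ℚ → c ℚ.≤ t →
  0ℚ ℚ.≤ C → 0ℚ ℚ.≤ B → 0ℚ ℚ.≤ η → ℚ.∣ D ∣ ℚ.≤ B →
  ℚ.∣ e′ ℚ.- e ℚ.- (ℚ.- t) ℚ.* e ∣ ℚ.≤ C ℚ.* (ℚ.∣ ℚ.- t ∣ ℚ.* ℚ.∣ ℚ.- t ∣) ℚ.+ η ℚ.* c →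
  (B ℚ.* C) ℚ.* t ℚ.≤ g → B ℚ.* η ℚ.≤ g →
  ℚ.∣ ((e ℚ.- e′) ℚ.* D) ℚ.* r ℚ.- e ℚ.* D ∣ ℚ.≤ g ℚ.+ g
quotient-error {e} {e′} {D} {t} {r} {c} {C} {B} {η} {g} 0≤t 0≤r tr≡1 c≤t 0≤C 0≤B 0≤η D≤B close BCt≤g Bη≤g = begin
  ℚ.∣ ((e ℚ.- e′) ℚ.* D) ℚ.* r ℚ.- e ℚ.* D ∣
    ≡⟨ cong ℚ.∣_∣ (trans (regroup e e′ D t r)
         (trans (cong (λ p → ℚ.- (τ ℚ.* D ℚ.* r) ℚ.+ (p ℚ.- 1ℚ) ℚ.* (e ℚ.* D)) tr≡1)
                (vanish (τ ℚ.* D ℚ.* r) (e ℚ.* D)))) ⟩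
  ℚ.∣ ℚ.- (τ ℚ.* D ℚ.* r) ∣
    ≡⟨ trans (ℚₚ.∣-p∣≡∣p∣ (τ ℚ.* D ℚ.* r)) (trans (ℚₚ.∣p*q∣≡∣p∣*∣q∣ (τ ℚ.* D) r)
         (cong₂ ℚ._*_ (ℚₚ.∣p*q∣≡∣p∣*∣q∣ τ D) (ℚₚ.0≤p⇒∣p∣≡p 0≤r))) ⟩
  (ℚ.∣ τ ∣ ℚ.* ℚ.∣ D ∣) ℚ.* r
    ≤⟨ ℚₚ.*-monoʳ-≤-nonNeg r {{ℚ.nonNegative 0≤r}} (*-mono-≤ (ℚₚ.0≤∣p∣ τ) 0≤B τ≤ D≤B) ⟩
  ((C ℚ.* (t ℚ.* t) ℚ.+ η ℚ.* t) ℚ.* B) ℚ.* r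
    ≡⟨ collect C t η B r ⟩
  (t ℚ.* r) ℚ.* ((B ℚ.* C) ℚ.* t ℚ.+ B ℚ.* η)
    ≡⟨ trans (cong (ℚ._* ((B ℚ.* C) ℚ.* t ℚ.+ B ℚ.* η)) tr≡1) (ℚₚ.*-identityˡ _) ⟩
  (B ℚ.* C) ℚ.* t ℚ.+ B ℚ.* η
    ≤⟨ ℚₚ.+-mono-≤ BCt≤g Bη≤g ⟩
  g ℚ.+ g ∎
  where
  open ℚₚ.≤-Reasoning
  τ = e′ ℚ.- e ℚ.- (ℚ.- t) ℚ.* e
  regroup : ∀ e e′ D t r → ((e ℚ.- e′) ℚ.* D) ℚ.* r ℚ.- e ℚ.* D ≡
    ℚ.- ((e′ ℚ.- e ℚ.- (ℚ.- t) ℚ.* e) ℚ.* D ℚ.* r) ℚ.+ (t ℚ.* r ℚ.- 1ℚ) ℚ.* (e ℚ.* D)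
  regroup = solve 5 (λ e e′ D t r → ((e :- e′) :* D) :* r :- e :* D :=
    :- ((e′ :- e :- (:- t) :* e) :* D :* r) :+ (t :* r :- con 1ℚ) :* (e :* D)) refl
  vanish : ∀ p q → ℚ.- p ℚ.+ (1ℚ ℚ.- 1ℚ) ℚ.* q ≡ ℚ.- p
  vanish = solve 2 (λ p q → :- p :+ (con 1ℚ :- con 1ℚ) :* q := :- p) refl
  collect : ∀ C t η B r → ((C ℚ.* (t ℚ.* t) ℚ.+ η ℚ.* t) ℚ.* B) ℚ.* r ≡
    (t ℚ.* r) ℚ.* ((B ℚ.* C) ℚ.* t ℚ.+ B ℚ.* η)
  collect = solve 5 (λ C t η B r → ((C :* (t :* t) :+ η :* t) :* B) :* r :=
    (t :* r) :* ((B :* C) :* t :+ B :* η)) refl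
  ∣-t∣≡t : ℚ.∣ ℚ.- t ∣ ≡ t
  ∣-t∣≡t = trans (ℚₚ.∣-p∣≡∣p∣ t) (ℚₚ.0≤p⇒∣p∣≡p 0≤t)
  τ≤ : ℚ.∣ τ ∣ ℚ.≤ C ℚ.* (t ℚ.* t) ℚ.+ η ℚ.* t
  τ≤ = ℚₚ.≤-trans close (ℚₚ.+-mono-≤
    (ℚₚ.≤-reflexive (cong (λ p → C ℚ.* (p ℚ.* p)) ∣-t∣≡t))
    (ℚₚ.*-monoˡ-≤-nonNeg η {{ℚ.nonNegative 0≤η}} c≤t))

module Derivative (a D : ℝ) (A B C : ℚ) (0<B : 0ℚ ℚ.< B) (0<C : 0ℚ ℚ.< C)
  (a≤A : ∀ n → ℚ.∣ seq a n ∣ ℚ.≤ A) (D≤B : ∀ n → ℚ.∣ seq D n ∣ ℚ.≤ B)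
  (expand : IsTaylorConstant (A ℚ.+ 1ℚ) C) where

  BC = B ℚ.* C
  0<BC : 0ℚ ℚ.< BC
  0<BC = *-pos 0<B 0<C

  module At (g : ℚ) (0<g : 0ℚ ℚ.< g) where

    ¼g = ½ ℚ.* (½ ℚ.* g)
    0<¼g : 0ℚ ℚ.< ¼g
    0<¼g = ½-pos (½-pos 0<g)

    -- t ≤ 1 keeps a + t below A + 1; t ≤ g / (4 B C) makes the Taylor error small.
    δ : ℚ
    δ = 1ℚ ℚ.⊓ (¼g ℚ.* recip BC 0<BC)
    0<δ : 0ℚ ℚ.< δ
    0<δ = ⊓-pos 0<1 (*-pos 0<¼g (recip-pos BC 0<BC))

    η = ¼g ℚ.* recip B 0<B
    0<η : 0ℚ ℚ.< η
    0<η = *-pos 0<¼g (recip-pos B 0<B)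

    small : ∀ t (0<t : 0ℝ < t) → t < fromℚ δ → ∃ λ N → ∀ n → N ℕ.≤ n →
      ℚ.∣ ((seq (exp (- a)) n ℚ.- seq (exp (- (a + t))) n) ℚ.* seq D n) ℚ.* seq (inv t 0<t) n
          ℚ.- seq (exp (- a)) n ℚ.* seq D n ∣ ℚ.≤ ½ ℚ.* g
    small t 0<t@(mk< c 0<c s above) (mk< c′ 0<c′ s′ below) = N ℕ.⊔ S , bound
      where
      S = s ℕ.⊔ s′
      c≤t : ∀ n → S ℕ.≤ n → c ℚ.≤ seq t n
      c≤t n S≤n = ℚₚ.≤-trans (ℚₚ.≤-reflexive (sym (ℚₚ.+-identityˡ c))) (above n (ℕₚ.m⊔n≤o⇒m≤o s s′ S≤n))
      0≤t : ∀ n → S ℕ.≤ n → 0ℚ ℚ.≤ seq t n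
      0≤t n S≤n = ℚₚ.≤-trans (ℚₚ.<⇒≤ 0<c) (c≤t n S≤n)
      t≤δ : ∀ n → S ℕ.≤ n → seq t n ℚ.≤ δ
      t≤δ n S≤n = ℚₚ.≤-trans (≤+nonneg (ℚₚ.<⇒≤ 0<c′)) (below n (ℕₚ.m⊔n≤o⇒n≤o s s′ S≤n))
      a-bounded : ∣ - a ∣ ≤ fromℚ (A ℚ.+ 1ℚ)
      a-bounded = mk≤ λ ε 0<ε → 0 , λ n _ → ℚₚ.≤-trans
        (ℚₚ.≤-trans (ℚₚ.≤-reflexive (ℚₚ.∣-p∣≡∣p∣ (seq a n))) (a≤A n))
        (ℚₚ.≤-trans (≤+nonneg (ℚₚ.<⇒≤ 0<1)) (≤+nonneg (ℚₚ.<⇒≤ 0<ε)))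
      a+t-bounded : ∣ - a + - t ∣ ≤ fromℚ (A ℚ.+ 1ℚ)
      a+t-bounded = mk≤ λ ε 0<ε → S , λ n S≤n → ℚₚ.≤-trans
        (ℚₚ.≤-trans (ℚₚ.∣p+q∣≤∣p∣+∣q∣ (ℚ.- seq a n) (ℚ.- seq t n))
          (ℚₚ.+-mono-≤ (ℚₚ.≤-trans (ℚₚ.≤-reflexive (ℚₚ.∣-p∣≡∣p∣ (seq a n))) (a≤A n))
            (ℚₚ.≤-trans (ℚₚ.≤-reflexive (trans (ℚₚ.∣-p∣≡∣p∣ (seq t n)) (ℚₚ.0≤p⇒∣p∣≡p (0≤t n S≤n))))
              (ℚₚ.≤-trans (t≤δ n S≤n) (ℚₚ.p⊓q≤p 1ℚ (¼g ℚ.* recip BC 0<BC))))))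
        (≤+nonneg (ℚₚ.<⇒≤ 0<ε))
      taylored : ∃ λ N → ∀ n → N ℕ.≤ n →
        ℚ.∣ expSum (ℚ.- seq a n ℚ.+ ℚ.- seq t n) n ℚ.- seq (exp (- a)) n ℚ.- (ℚ.- seq t n) ℚ.* seq (exp (- a)) n ∣
        ℚ.≤ C ℚ.* (ℚ.∣ ℚ.- seq t n ∣ ℚ.* ℚ.∣ ℚ.- seq t n ∣) ℚ.+ η ℚ.* c
      taylored = eventually (expand (- a) (- t) a-bounded a+t-bounded) (η ℚ.* c) (*-pos 0<η 0<c)
      N = proj₁ taylored
      bound : ∀ n → N ℕ.⊔ S ℕ.≤ n →
        ℚ.∣ ((seq (exp (- a)) n ℚ.- seq (exp (- (a + t))) n) ℚ.* seq D n) ℚ.* seq (inv t 0<t) n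
            ℚ.- seq (exp (- a)) n ℚ.* seq D n ∣ ℚ.≤ ½ ℚ.* g
      bound n N≤n = ℚₚ.≤-trans
        (quotient-error {seq (exp (- a)) n} {seq (exp (- (a + t))) n} {seq D n} {seq t n} {r} {c} {C} {B} {η} {¼g}
          (0≤t n S≤n) (ℚₚ.<⇒≤ (recip-pos (c ℚ.⊔ seq t n) (max-pos 0<c (seq t n)))) tr≡1 (c≤t n S≤n)
          (ℚₚ.<⇒≤ 0<C) (ℚₚ.<⇒≤ 0<B) (ℚₚ.<⇒≤ 0<η) (D≤B n)
          (subst (λ p → ℚ.∣ p ℚ.- seq (exp (- a)) n ℚ.- (ℚ.- seq t n) ℚ.* seq (exp (- a)) n ∣ ℚ.≤
                        C ℚ.* (ℚ.∣ ℚ.- seq t n ∣ ℚ.* ℚ.∣ ℚ.- seq t n ∣) ℚ.+ η ℚ.* c)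
            (cong (λ q → expSum q n) (sym (ℚₚ.neg-distrib-+ (seq a n) (seq t n))))
            (proj₂ taylored n (ℕₚ.m⊔n≤o⇒m≤o N S N≤n)))
          (ℚₚ.≤-trans (ℚₚ.*-monoˡ-≤-nonNeg BC {{ℚ.nonNegative (ℚₚ.<⇒≤ 0<BC)}}
              (ℚₚ.≤-trans (t≤δ n S≤n) (ℚₚ.p⊓q≤q 1ℚ (¼g ℚ.* recip BC 0<BC))))
            (ℚₚ.≤-reflexive (quotient-cancel ¼g BC 0<BC)))
          (ℚₚ.≤-reflexive (quotient-cancel ¼g B 0<B)))
        (ℚₚ.≤-reflexive (½+½ (½ ℚ.* g)))
        where
        S≤n = ℕₚ.m⊔n≤o⇒n≤o N S N≤n
        r = recip (c ℚ.⊔ seq t n) (max-pos 0<c (seq t n))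
        -- As c ≤ t, the maximum in the definition of inv is t itself.
        tr≡1 : seq t n ℚ.* r ≡ 1ℚ
        tr≡1 = trans (cong (ℚ._* r) (sym (ℚₚ.p≤q⇒p⊔q≡q (c≤t n S≤n))))
                     (recip-inv (c ℚ.⊔ seq t n) (max-pos 0<c (seq t n)))

  limit : (q : (t : ℝ) → 0ℝ < t → ℝ) (L : ℝ) →
    (∀ t (0<t : 0ℝ < t) → q t 0<t ≐ ((exp (- a) - exp (- (a + t))) * D) * inv t 0<t) →
    L ≐ exp (- a) * D → IsLimit₀₊ q L
  limit q L q≐ L≐ ε (mk< g 0<g s ε-above) = fromℚ (At.δ g 0<g) ,
    mk< (At.δ g 0<g) (At.0<δ g 0<g) 0 (λ n _ → ℚₚ.≤-reflexive (ℚₚ.+-identityˡ (At.δ g 0<g))) ,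
    λ t 0<t t<δ →
      let N , bound = At.small g 0<g t 0<t t<δ
      in mk< (½ ℚ.* g) (½-pos 0<g) (N ℕ.⊔ s) λ n N≤n → ℚₚ.≤-trans
        (ℚₚ.+-monoˡ-≤ (½ ℚ.* g) (ℚₚ.≤-trans
          (ℚₚ.≤-reflexive (cong₂ (λ p l → ℚ.∣ p ℚ.- l ∣) (q≐ t 0<t n) (L≐ n)))
          (bound n (ℕₚ.m⊔n≤o⇒m≤o N s N≤n))))
        (ℚₚ.≤-trans (ℚₚ.≤-reflexive (trans (½+½ g) (sym (ℚₚ.+-identityˡ g))))
          (ε-above n (ℕₚ.m⊔n≤o⇒n≤o N s N≤n)))

exp-derivative : ∀ a D (q : (t : ℝ) → 0ℝ < t → ℝ) L →
  (∀ t (0<t : 0ℝ < t) → q t 0<t ≐ ((exp (- a) - exp (- (a + t))) * D) * inv t 0<t) →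
  L ≐ exp (- a) * D → IsLimit₀₊ q L
exp-derivative a D =
  let A , 0<A , a≤A = bounded (cauchy a)
      B , 0<B , D≤B = bounded (cauchy D)
      C , 0<C , expand = taylor (A ℚ.+ 1ℚ) (0≤+ (ℚₚ.<⇒≤ 0<A) (ℚₚ.<⇒≤ 0<1))
  in Derivative.limit a D A B C 0<B 0<C a≤A D≤B expand

-- Both bounds are used at one and the same rational t, half of the smaller gap
-- that certifies the two radii to be positive.
limit-unique : ∀ {q L K} → IsLimit₀₊ q L → IsLimit₀₊ q K → L ≤ K
limit-unique {q} {L} {K} q→L q→K = mk≤ λ ε 0<ε →
  compare ε (q→L (fromℚ (½ ℚ.* ε)) (positive (½-pos 0<ε))) (q→K (fromℚ (½ ℚ.* ε)) (positive (½-pos 0<ε)))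
  where
  positive : ∀ {p} → 0ℚ ℚ.< p → 0ℝ < fromℚ p
  positive {p} 0<p = mk< p 0<p 0 λ _ _ → ℚₚ.≤-reflexive (ℚₚ.+-identityˡ p)
  half-below : ∀ {g m δ s} → 0ℚ ℚ.< m → m ℚ.≤ g → (∀ n → s ℕ.≤ n → 0ℚ ℚ.+ g ℚ.≤ seq δ n) →
    fromℚ (½ ℚ.* m) < δ
  half-below {g} {m} {δ} {s} 0<m m≤g above = mk< (½ ℚ.* m) (½-pos 0<m) s λ n s≤n →
    ℚₚ.≤-trans (ℚₚ.≤-reflexive (½+½ m)) (ℚₚ.≤-trans m≤g
      (ℚₚ.≤-trans (ℚₚ.≤-reflexive (sym (ℚₚ.+-identityˡ g))) (above n s≤n)))
  triangle : ∀ {p l k e} → ℚ.∣ p ℚ.- l ∣ ℚ.≤ e → ℚ.∣ p ℚ.- k ∣ ℚ.≤ e → l ℚ.≤ k ℚ.+ (e ℚ.+ e)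
  triangle {p} {l} {k} {e} pl pk = slack
    (0≤+ (deficit (ℚₚ.≤-trans (-p≤∣p∣ (p ℚ.- l)) pl)) (deficit (ℚₚ.≤-trans (p≤∣p∣ (p ℚ.- k)) pk)))
    (solve 4 (λ p l k e → l :+ ((e :- (:- (p :- l))) :+ (e :- (p :- k))) := k :+ (e :+ e)) refl p l k e)
  Near : ℝ → ℚ → Set
  Near L ε = ∃ λ δ → 0ℝ < δ × (∀ t (0<t : 0ℝ < t) → t < δ → ∣ q t 0<t - L ∣ < fromℚ ε)
  compare : ∀ ε → Near L (½ ℚ.* ε) → Near K (½ ℚ.* ε) →
    ∃ λ N → ∀ n → N ℕ.≤ n → seq L n ℚ.≤ seq K n ℚ.+ ε
  compare ε (δ₁ , mk< g₁ 0<g₁ s₁ above₁ , near₁) (δ₂ , mk< g₂ 0<g₂ s₂ above₂ , near₂) =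
    combine (near₁ t 0<t (half-below 0<m (ℚₚ.p⊓q≤p g₁ g₂) above₁))
            (near₂ t 0<t (half-below 0<m (ℚₚ.p⊓q≤q g₁ g₂) above₂))
    where
    m = g₁ ℚ.⊓ g₂
    0<m = ⊓-pos 0<g₁ 0<g₂
    t = fromℚ (½ ℚ.* m)
    0<t : 0ℝ < t
    0<t = positive (½-pos 0<m)
    combine : ∣ q t 0<t - L ∣ < fromℚ (½ ℚ.* ε) → ∣ q t 0<t - K ∣ < fromℚ (½ ℚ.* ε) →
      ∃ λ N → ∀ n → N ℕ.≤ n → seq L n ℚ.≤ seq K n ℚ.+ ε
    combine (mk< c 0<c s toL) (mk< c′ 0<c′ s′ toK) = s ℕ.⊔ s′ , λ n S≤n → ℚₚ.≤-trans
      (triangle {seq (q t 0<t) n}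
        (ℚₚ.≤-trans (≤+nonneg (ℚₚ.<⇒≤ 0<c)) (toL n (ℕₚ.m⊔n≤o⇒m≤o s s′ S≤n)))
        (ℚₚ.≤-trans (≤+nonneg (ℚₚ.<⇒≤ 0<c′)) (toK n (ℕₚ.m⊔n≤o⇒n≤o s s′ S≤n))))
      (ℚₚ.≤-reflexive (cong (seq K n ℚ.+_) (½+½ ε)))

-- Submodular functions

insert : ∀ {n} → Fin n → Subset n → Subset n
insert v S = S [ v ]≔ inside

insert-⊆ : ∀ {n} v (S : Subset n) → S ⊆ insert v S
insert-⊆ zero    (s ∷ S) here        = here
insert-⊆ zero    (s ∷ S) (there x∈S) = there x∈S
insert-⊆ (suc v) (s ∷ S) here        = here
insert-⊆ (suc v) (s ∷ S) (there x∈S) = there (insert-⊆ v S x∈S)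

∈-insert : ∀ {n} v (S : Subset n) → v ∈ insert v S
∈-insert v S = Vecₚ.lookup⇒[]= v (insert v S) (Vecₚ.lookup∘updateAt v S)

insert-⊆-∪ : ∀ {n} v (S T : Subset n) → insert v T ⊆ T ∪ insert v S
insert-⊆-∪ v S T {u} u∈ with u ≟ᶠ v
... | yes refl = x∈p∪q⁺ {p = T} {insert v S} (inj₂ (∈-insert v S))
... | no  u≢v  = x∈p∪q⁺ {p = T} {insert v S} (inj₁ (Vecₚ.lookup⇒[]= u T
  (trans (sym (Vecₚ.lookup∘updateAt′ u v u≢v T)) (Vecₚ.[]=⇒lookup u∈))))

insertAll : ∀ {n} → List (Fin n) → Subset n → Subset n
insertAll vs S = foldr insert S vs

⊆-insertAll : ∀ {n} vs (S : Subset n) → S ⊆ insertAll vs S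
⊆-insertAll []       S x∈S = x∈S
⊆-insertAll (v ∷ vs) S x∈S = insert-⊆ v (insertAll vs S) (⊆-insertAll vs S x∈S)

∈-insertAll : ∀ {n} {v : Fin n} vs (S : Subset n) → v List.∈ vs → v ∈ insertAll vs S
∈-insertAll (v ∷ vs) S (here refl)  = ∈-insert v (insertAll vs S)
∈-insertAll (v ∷ vs) S (there v∈vs) = insert-⊆ v (insertAll vs S) (∈-insertAll vs S v∈vs)

module _ {n : ℕ} (f : Subset n → ℝ) (mono : Monotone f) (submod : Submodular f) where

  -- Diminishing returns: submodularity for T and insert v S, whose union contains
  -- insert v T and whose intersection contains S.
  gain-anti : ∀ v S T → S ⊆ T → f (insert v T) + f S ≤ f T + f (insert v S)
  gain-anti v S T S⊆T = ≤-trans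
    {f (insert v T) + f S} {f (T ∪ insert v S) + f (T ∩ insert v S)} {f T + f (insert v S)}
    (+-mono-≤ {f (insert v T)} {f (T ∪ insert v S)} {f S} {f (T ∩ insert v S)}
      (mono _ _ (insert-⊆-∪ v S T))
      (mono _ _ (λ x∈S → x∈p∩q⁺ (S⊆T x∈S , insert-⊆ v S x∈S))))
    (submod T (insert v S))

  -- Each element gains at most what it would gain when inserted into S directly.
  insertAll-gain : ∀ vs S → f (insertAll vs S) ≤ f S + ∑ vs (λ v → gain f v S)
  insertAll-gain []       S = ≐⇒≤ {f S} {f S + ∑ [] (λ v → gain f v S)} λ k → sym (ℚₚ.+-identityʳ (seq (f S) k))
  insertAll-gain (v ∷ vs) S = ≤-rearrange
    {(f (insert v T) + f S) + f T} {(f T + f (insert v S)) + (f S + ∑ vs (λ v → gain f v S))}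
    {f (insert v T)} {f S + ∑ (v ∷ vs) (λ v → gain f v S)}
    (λ k → identity (seq (f (insert v T)) k) (seq (f S) k) (seq (f T) k) (seq (f (insert v S)) k)
                    (seq (∑ vs (λ v → gain f v S)) k))
    (+-mono-≤ {f (insert v T) + f S} {f T + f (insert v S)} {f T} {f S + ∑ vs (λ v → gain f v S)}
      (gain-anti v S T (⊆-insertAll vs S)) (insertAll-gain vs S))
    where
    T = insertAll vs S
    identity : ∀ x s t y σ → ((t ℚ.+ y) ℚ.+ (s ℚ.+ σ)) ℚ.- ((x ℚ.+ s) ℚ.+ t) ≡
      (s ℚ.+ ((y ℚ.- s) ℚ.+ σ)) ℚ.- x
    identity = solve 5 (λ x s t y σ → ((t :+ y) :+ (s :+ σ)) :- ((x :+ s) :+ t) :=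
      (s :+ ((y :- s) :+ σ)) :- x) refl

  -- Inserting all of O into S yields a set that contains O.
  submodular-bound : ∀ O S → f O ≤ f S + ∑ (elements O) (λ v → gain f v S)
  submodular-bound O S = ≤-trans {f O} {f (insertAll (elements O) S)} {f S + ∑ (elements O) (λ v → gain f v S)}
    (mono _ _ λ x∈O → ∈-insertAll (elements O) S (∈-filter⁺ (_∈? O) (∈-allFin _) x∈O))
    (insertAll-gain (elements O) S)

-- Marginal values

influence : ∀ {n} → (Subset n → ℝ) → Vector ℝ n → Fin n → ℝ
influence f A v = 𝔼 (absence A) (effect f v)

-- The derivative of the extension in the coordinate v, by the chain rule: the
-- extension is affine in exp (- A v) with slope - influence.
marginal : ∀ {n} → (Subset n → ℝ) → Vector ℝ n → Fin n → ℝ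
marginal f A v = exp (- A v) * influence f A v

𝔼-gain≐marginal : ∀ {n} (f : Subset n → ℝ) A v → 𝔼 (absence A) (gain f v) ≐ marginal f A v
𝔼-gain≐marginal f A v = 𝔼-gain (absence A) f v {gain f v} {effect f v} (λ _ _ → refl) (λ _ _ → refl)

differenceQuotient≐ : ∀ {n} (f : Subset n → ℝ) A v t (0<t : 0ℝ < t) →
  differenceQuotient f A v t 0<t ≐
  ((exp (- A v) - exp (- (A v + t))) * influence f A v) * inv t 0<t
differenceQuotient≐ f A v t 0<t k = cong (ℚ._* seq (inv t 0<t) k) (trans
  (cong₂ ℚ._-_ (extension≐𝔼 f (increase A v t) k) (extension≐𝔼 f A k))
  (trans (𝔼-affine (absence A) (absence (increase A v t)) f v {effect f v} unchanged (λ _ _ → refl) k)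
    (cong (λ a → (seq (exp (- A v)) k ℚ.- expSum (ℚ.- a) k) ℚ.* seq (influence f A v) k)
      (cong (λ x → seq x k) (updateAt-updates v A)))))
  where
  unchanged : ∀ u → u ≢ v → absence (increase A v t) u ≐ absence A u
  unchanged u u≢v k = cong (λ x → expSum (ℚ.- seq x k) k) (updateAt-minimal u v A u≢v)

marginal-isMarginal : ∀ {n} (f : Subset n → ℝ) A v → IsMarginal f A v (marginal f A v)
marginal-isMarginal f A v = exp-derivative (A v) (influence f A v) (differenceQuotient f A v)
  (marginal f A v) (differenceQuotient≐ f A v) (λ _ → refl)

-- The bound for a fixed set S, averaged over S = R(A); averaging preserves it
-- because the weights are nonnegative and sum to 1.
extension-bound : ∀ {n} (f : Subset n → ℝ) → Monotone f → Submodular f →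
  ∀ O A → (∀ u → 0ℝ ≤ A u) → f O ≤ extension f A + ∑ (elements O) (marginal f A)
extension-bound f mono submod O A 0≤A = ≤-trans
  {f O} {𝔼 (absence A) (λ _ → f O)} {extension f A + ∑ (elements O) (marginal f A)}
  (≐⇒≤ {f O} {𝔼 (absence A) (λ _ → f O)} λ k → sym (𝔼-const (absence A) {λ _ → f O} (f O) (λ _ _ → refl) k))
  (≤-trans {𝔼 (absence A) (λ _ → f O)} {𝔼 (absence A) bound} {extension f A + ∑ (elements O) (marginal f A)}
    (𝔼-mono-≤ {x = absence A} {λ _ → f O} {bound}
      (λ u → exp-neg-nonneg (A u) (0≤A u)) (λ u → exp-neg≤1 (A u) (0≤A u))
      (submodular-bound f mono submod O))
    (≐⇒≤ {𝔼 (absence A) bound} {extension f A + ∑ (elements O) (marginal f A)} λ k → trans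
      (𝔼-+ (absence A) {f} {total} {bound} (λ _ _ → refl) k)
      (cong₂ ℚ._+_ (sym (extension≐𝔼 f A k))
        (trans (𝔼-∑ (absence A) (elements O) (gain f) {total} (λ _ _ → refl) k)
               (∑-cong (elements O) k)))))
  where
  total bound : Subset _ → ℝ
  total S = ∑ (elements O) (λ v → gain f v S)
  bound S = f S + ∑ (elements O) (λ v → gain f v S)
  ∑-cong : ∀ vs k → seq (∑ vs (λ v → 𝔼 (absence A) (gain f v))) k ≡ seq (∑ vs (marginal f A)) k
  ∑-cong []       k = refl
  ∑-cong (v ∷ vs) k = cong₂ ℚ._+_ (𝔼-gain≐marginal f A v k) (∑-cong vs k)

-- A given m v is the limit of the same difference quotient as marginal f A v, so
-- the bound for marginal f A carries over to m.
lemma4p5 : ∀ (n : ℕ) (f : Subset n → ℝ) → NonNegative f → Monotone f → Submodular f →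
    ∀ (O : Subset n) (A : Vector ℝ n) → (∀ u → 0ℝ ≤ A u) →
    (∀ v → ∃ λ L → IsMarginal f A v L) ×
    (∀ (m : Fin n → ℝ) → (∀ v → IsMarginal f A v (m v)) →
    f O ≤ extension f A + ∑ (elements O) m)
lemma4p5 n f _ mono submod O A 0≤A =
  (λ v → marginal f A v , marginal-isMarginal f A v) ,
  λ m m-marginal → ≤-trans
    {f O} {extension f A + ∑ (elements O) (marginal f A)} {extension f A + ∑ (elements O) m}
    (extension-bound f mono submod O A 0≤A)
    (+-mono-≤ {extension f A} {extension f A} {∑ (elements O) (marginal f A)} {∑ (elements O) m}
      ≤-refl
      (∑-mono-≤ (elements O) {marginal f A} {m} λ v →
        limit-unique {differenceQuotient f A v} {marginal f A v} {m v}
          (marginal-isMarginal f A v) (m-marginal v)))
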